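{- Let $t\ge 2$ be an integer and let $\gamma>0$ be real. Then there exists $d=d(\gamma,t)$ such that for all positive integers $m,n$, every $m\times n$ Boolean matrix $M$ with no $t\times t$ all-ones submatrix and with $\gamma_2(M)\le\gamma$ contains at most $d(m+n)$ one entries.
   Context: A Boolean matrix is a matrix with entries in $\{0,1\}$. A submatrix is obtained by choosing an arbitrary subset of the rows and an arbitrary subset of the columns. For a real $m\times n$ matrix $M$, $\gamma_2(M)=\min_{UV=M}\|U\|_{\mathrm{row}}\|V\|_{\mathrm{col}}$, where the minimum is over all factorizations of $M$ as a product $UV$ of real matrices, $\|U\|_{\mathrm{row}}$ is the maximum $\ell_2$-norm of a row of $U$, and $\|V\|_{\mathrm{col}}$ is the maximum $\ell_2$-norm of a column of $V$. -}

module Defs where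

open import Algebra.Bundles.Raw using (RawMonoid)
open import Algebra.Definitions.RawMonoid using () renaming (sum to monoidSum)
open import Data.Bool.Base using (Bool; true; if_then_else_)
open import Data.Fin.Base using (Fin)
open import Data.Fin.Subset using (Subset; _∈_; ∣_∣)
open import Data.Nat.Base as ℕ using (ℕ; _⊔_)
import Data.Nat.Properties as ℕₚ
open import Data.Product.Base using (∃-syntax; Σ-syntax; _×_; _,_)
open import Data.Rational.Base as ℚ using (ℚ; 0ℚ; 1ℚ; ½; Positive; positive; 1/_)
import Data.Rational.Properties as ℚₚ
open import Data.Rational.Solver using (module +-*-Solver)
open import Data.Vec.Functional using (Vector)
open import Relation.Binary.PropositionalEquality
  using (_≡_; refl; sym; trans; cong; subst)

-- The reals are Cauchy sequences of rationals, with _≃_ as equality; no rate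
-- of convergence is prescribed, so that the operations act termwise.

IsCauchy : (ℕ → ℚ) → Set
IsCauchy x = ∀ ε → 0ℚ ℚ.< ε →
  ∃[ N ] (∀ m n → N ℕ.≤ m → N ℕ.≤ n → ℚ.∣ x m ℚ.- x n ∣ ℚ.< ε)

record ℝ : Set where
  constructor mkℝ
  field
    seq    : ℕ → ℚ
    cauchy : IsCauchy seq

open ℝ public

infix 4 _≃_ _≤_ _<_

_≃_ : ℝ → ℝ → Set
x ≃ y = ∀ ε → 0ℚ ℚ.< ε →
  ∃[ N ] (∀ n → N ℕ.≤ n → ℚ.∣ seq x n ℚ.- seq y n ∣ ℚ.< ε)

-- A termwise comparison would not respect _≃_, hence the slack ε in _≤_
-- and the uniform gap ε in _<_.

_≤_ : ℝ → ℝ → Set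
x ≤ y = ∀ ε → 0ℚ ℚ.< ε →
  ∃[ N ] (∀ n → N ℕ.≤ n → seq x n ℚ.< seq y n ℚ.+ ε)

_<_ : ℝ → ℝ → Set
x < y = ∃[ ε ] (0ℚ ℚ.< ε) × ∃[ N ] (∀ n → N ℕ.≤ n → seq x n ℚ.+ ε ℚ.< seq y n)

private
  open +-*-Solver

  +-interchange : ∀ a b c d →
    (a ℚ.+ b) ℚ.- (c ℚ.+ d) ≡ (a ℚ.- c) ℚ.+ (b ℚ.- d)
  +-interchange = solve 4 (λ a b c d →
    (a :+ b) :- (c :+ d) := (a :- c) :+ (b :- d)) refl

  sub-add : ∀ a b → a ≡ (a ℚ.- b) ℚ.+ b
  sub-add = solve 2 (λ a b → a := (a :- b) :+ b) refl

  *-split : ∀ a b c d →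
    a ℚ.* b ℚ.- c ℚ.* d ≡ a ℚ.* (b ℚ.- d) ℚ.+ d ℚ.* (a ℚ.- c)
  *-split = solve 4 (λ a b c d →
    a :* b :- c :* d := a :* (b :- d) :+ d :* (a :- c)) refl

  half-pos : ∀ {ε} → 0ℚ ℚ.< ε → 0ℚ ℚ.< ½ ℚ.* ε
  half-pos {ε} 0<ε =
    ℚₚ.positive⁻¹ (½ ℚ.* ε) {{ℚₚ.pos*pos⇒pos ½ ε {{positive 0<ε}}}}

  half+half : ∀ ε → ½ ℚ.* ε ℚ.+ ½ ℚ.* ε ≡ ε
  half+half ε =
    trans (sym (ℚₚ.*-distribʳ-+ ε ½ ½)) (ℚₚ.*-identityˡ ε)

  const-cauchy : ∀ q → IsCauchy (λ _ → q)
  const-cauchy q ε 0<ε = 0 , λ _ _ _ _ →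
    subst (ℚ._< ε) (cong ℚ.∣_∣ (sym (ℚₚ.+-inverseʳ q))) 0<ε

  +-cauchy : ∀ {x y} → IsCauchy x → IsCauchy y → IsCauchy (λ n → x n ℚ.+ y n)
  +-cauchy {x} {y} cx cy ε 0<ε =
    let N₁ , h₁ = cx (½ ℚ.* ε) (half-pos 0<ε)
        N₂ , h₂ = cy (½ ℚ.* ε) (half-pos 0<ε) in
    N₁ ⊔ N₂ , λ m n N≤m N≤n →
    let open ℚₚ.≤-Reasoning in begin-strict
      ℚ.∣ (x m ℚ.+ y m) ℚ.- (x n ℚ.+ y n) ∣
        ≡⟨ cong ℚ.∣_∣ (+-interchange (x m) (y m) (x n) (y n)) ⟩
      ℚ.∣ (x m ℚ.- x n) ℚ.+ (y m ℚ.- y n) ∣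
        ≤⟨ ℚₚ.∣p+q∣≤∣p∣+∣q∣ (x m ℚ.- x n) (y m ℚ.- y n) ⟩
      ℚ.∣ x m ℚ.- x n ∣ ℚ.+ ℚ.∣ y m ℚ.- y n ∣
        <⟨ ℚₚ.+-mono-<
             (h₁ m n (ℕₚ.m⊔n≤o⇒m≤o N₁ N₂ N≤m) (ℕₚ.m⊔n≤o⇒m≤o N₁ N₂ N≤n))
             (h₂ m n (ℕₚ.m⊔n≤o⇒n≤o N₁ N₂ N≤m) (ℕₚ.m⊔n≤o⇒n≤o N₁ N₂ N≤n)) ⟩
      ½ ℚ.* ε ℚ.+ ½ ℚ.* ε
        ≡⟨ half+half ε ⟩
      ε ∎

  bounded : ∀ {x} → IsCauchy x →
    ∃[ B ] Positive B × ∃[ N ] (∀ n → N ℕ.≤ n → ℚ.∣ x n ∣ ℚ.≤ B)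
  bounded {x} cx =
    let N , h = cx 1ℚ (ℚₚ.positive⁻¹ 1ℚ) in
    1ℚ ℚ.+ ℚ.∣ x N ∣ ,
    ℚₚ.pos+nonNeg⇒pos 1ℚ ℚ.∣ x N ∣ {{ℚₚ.∣-∣-nonNeg (x N)}} ,
    N , λ n N≤n →
    let open ℚₚ.≤-Reasoning in begin
      ℚ.∣ x n ∣
        ≡⟨ cong ℚ.∣_∣ (sub-add (x n) (x N)) ⟩
      ℚ.∣ (x n ℚ.- x N) ℚ.+ x N ∣
        ≤⟨ ℚₚ.∣p+q∣≤∣p∣+∣q∣ (x n ℚ.- x N) (x N) ⟩
      ℚ.∣ x n ℚ.- x N ∣ ℚ.+ ℚ.∣ x N ∣
        ≤⟨ ℚₚ.+-monoˡ-≤ ℚ.∣ x N ∣ (ℚₚ.<⇒≤ (h n N N≤n ℕₚ.≤-refl)) ⟩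
      1ℚ ℚ.+ ℚ.∣ x N ∣ ∎

  shrink : ∀ C → Positive C → ∀ ε → 0ℚ ℚ.< ε →
    ∃[ δ ] (0ℚ ℚ.< δ) × (C ℚ.* δ ≡ ε)
  shrink C posC ε 0<ε = C⁻¹ ℚ.* ε , 0<C⁻¹ε , CC⁻¹ε≡ε
    where
    instance
      C-pos : Positive C
      C-pos = posC
      C≢0 : ℚ.NonZero C
      C≢0 = ℚₚ.pos⇒nonZero C
    C⁻¹ : ℚ
    C⁻¹ = 1/ C
    0<C⁻¹ε : 0ℚ ℚ.< C⁻¹ ℚ.* ε
    0<C⁻¹ε = ℚₚ.positive⁻¹ (C⁻¹ ℚ.* ε)
      {{ℚₚ.pos*pos⇒pos C⁻¹ {{ℚₚ.1/pos⇒pos C}} ε {{positive 0<ε}}}}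
    CC⁻¹ε≡ε : C ℚ.* (C⁻¹ ℚ.* ε) ≡ ε
    CC⁻¹ε≡ε = trans (sym (ℚₚ.*-assoc C C⁻¹ ε))
      (trans (cong (ℚ._* ε) (ℚₚ.*-inverseʳ C)) (ℚₚ.*-identityˡ ε))

  scale : ∀ p q K δ → Positive K → ℚ.∣ p ∣ ℚ.≤ K → ℚ.∣ q ∣ ℚ.< δ →
          ℚ.∣ p ℚ.* q ∣ ℚ.< K ℚ.* δ
  scale p q K δ posK ∣p∣≤K ∣q∣<δ = begin-strict
    ℚ.∣ p ℚ.* q ∣           ≡⟨ ℚₚ.∣p*q∣≡∣p∣*∣q∣ p q ⟩
    ℚ.∣ p ∣ ℚ.* ℚ.∣ q ∣     ≤⟨ ℚₚ.*-monoʳ-≤-nonNeg ℚ.∣ q ∣ {{ℚₚ.∣-∣-nonNeg q}} ∣p∣≤K ⟩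
    K ℚ.* ℚ.∣ q ∣           <⟨ ℚₚ.*-monoʳ-<-pos K {{posK}} ∣q∣<δ ⟩
    K ℚ.* δ                 ∎
    where open ℚₚ.≤-Reasoning

  *-close : ∀ a b c d A B δ → Positive A → Positive B →
    ℚ.∣ a ∣ ℚ.≤ A → ℚ.∣ d ∣ ℚ.≤ B → ℚ.∣ a ℚ.- c ∣ ℚ.< δ → ℚ.∣ b ℚ.- d ∣ ℚ.< δ →
    ℚ.∣ a ℚ.* b ℚ.- c ℚ.* d ∣ ℚ.< (A ℚ.+ B) ℚ.* δ
  *-close a b c d A B δ posA posB a≤A d≤B a~c b~d = begin-strict
    ℚ.∣ a ℚ.* b ℚ.- c ℚ.* d ∣
      ≡⟨ cong ℚ.∣_∣ (*-split a b c d) ⟩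
    ℚ.∣ a ℚ.* (b ℚ.- d) ℚ.+ d ℚ.* (a ℚ.- c) ∣
      ≤⟨ ℚₚ.∣p+q∣≤∣p∣+∣q∣ (a ℚ.* (b ℚ.- d)) (d ℚ.* (a ℚ.- c)) ⟩
    ℚ.∣ a ℚ.* (b ℚ.- d) ∣ ℚ.+ ℚ.∣ d ℚ.* (a ℚ.- c) ∣
      <⟨ ℚₚ.+-mono-< (scale a (b ℚ.- d) A δ posA a≤A b~d)
                     (scale d (a ℚ.- c) B δ posB d≤B a~c) ⟩
    A ℚ.* δ ℚ.+ B ℚ.* δ
      ≡⟨ ℚₚ.*-distribʳ-+ δ A B ⟨
    (A ℚ.+ B) ℚ.* δ ∎
    where open ℚₚ.≤-Reasoning

  *-cauchy : ∀ {x y} → IsCauchy x → IsCauchy y → IsCauchy (λ n → x n ℚ.* y n)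
  *-cauchy {x} {y} cx cy ε 0<ε =
    let A , posA , N₁ , hA = bounded cx
        B , posB , N₂ , hB = bounded cy
        δ , 0<δ , Cδ≡ε = shrink (A ℚ.+ B) (ℚₚ.pos+pos⇒pos A {{posA}} B {{posB}}) ε 0<ε
        N₃ , hx = cx δ 0<δ
        N₄ , hy = cy δ 0<δ
    in (N₁ ⊔ N₂) ⊔ (N₃ ⊔ N₄) , λ m n N≤m N≤n →
    subst (ℚ.∣ x m ℚ.* y m ℚ.- x n ℚ.* y n ∣ ℚ.<_) Cδ≡ε
      (*-close (x m) (y m) (x n) (y n) A B δ posA posB
        (hA m (ℕₚ.m⊔n≤o⇒m≤o N₁ N₂ (ℕₚ.m⊔n≤o⇒m≤o (N₁ ⊔ N₂) (N₃ ⊔ N₄) N≤m)))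
        (hB n (ℕₚ.m⊔n≤o⇒n≤o N₁ N₂ (ℕₚ.m⊔n≤o⇒m≤o (N₁ ⊔ N₂) (N₃ ⊔ N₄) N≤n)))
        (hx m n (ℕₚ.m⊔n≤o⇒m≤o N₃ N₄ (ℕₚ.m⊔n≤o⇒n≤o (N₁ ⊔ N₂) (N₃ ⊔ N₄) N≤m)) (ℕₚ.m⊔n≤o⇒m≤o N₃ N₄ (ℕₚ.m⊔n≤o⇒n≤o (N₁ ⊔ N₂) (N₃ ⊔ N₄) N≤n)))
        (hy m n (ℕₚ.m⊔n≤o⇒n≤o N₃ N₄ (ℕₚ.m⊔n≤o⇒n≤o (N₁ ⊔ N₂) (N₃ ⊔ N₄) N≤m)) (ℕₚ.m⊔n≤o⇒n≤o N₃ N₄ (ℕₚ.m⊔n≤o⇒n≤o (N₁ ⊔ N₂) (N₃ ⊔ N₄) N≤n))))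

fromℚ : ℚ → ℝ
fromℚ q = mkℝ (λ _ → q) (const-cauchy q)

0ℝ 1ℝ : ℝ
0ℝ = fromℚ 0ℚ
1ℝ = fromℚ 1ℚ

infixl 6 _+_
infixl 7 _*_

_+_ : ℝ → ℝ → ℝ
x + y = mkℝ (λ n → seq x n ℚ.+ seq y n) (+-cauchy {seq x} {seq y} (cauchy x) (cauchy y))

_*_ : ℝ → ℝ → ℝ
x * y = mkℝ (λ n → seq x n ℚ.* seq y n) (*-cauchy {seq x} {seq y} (cauchy x) (cauchy y))

+-0-rawMonoid : RawMonoid _ _
+-0-rawMonoid = record { Carrier = ℝ ; _≈_ = _≃_ ; _∙_ = _+_ ; ε = 0ℝ }

∑ : ∀ {n} → Vector ℝ n → ℝ
∑ = monoidSum +-0-rawMonoid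

IsMaximum : (ℝ → Set) → ℝ → Set
IsMaximum P a = P a × (∀ b → P b → b ≤ a)

IsMinimum : (ℝ → Set) → ℝ → Set
IsMinimum P a = P a × (∀ b → P b → a ≤ b)

Matrix : Set → ℕ → ℕ → Set
Matrix A m n = Fin m → Fin n → A

infix 4 _≃ₘ_

_≃ₘ_ : ∀ {m n} → Matrix ℝ m n → Matrix ℝ m n → Set
A ≃ₘ B = ∀ i j → A i j ≃ B i j

infixl 7 _*ₘ_

_*ₘ_ : ∀ {m k n} → Matrix ℝ m k → Matrix ℝ k n → Matrix ℝ m n
(U *ₘ V) i j = ∑ (λ l → U i l * V l j)

-- IsNorm v r says that r is the square root of Σ vₗ², i.e. the ℓ₂-norm of v.
IsNorm : ∀ {k} → Vector ℝ k → ℝ → Set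
IsNorm v r = 0ℝ ≤ r × r * r ≃ ∑ (λ l → v l * v l)

IsRowNorm : ∀ {m k} → Matrix ℝ m k → ℝ → Set
IsRowNorm U = IsMaximum (λ r → ∃[ i ] IsNorm (U i) r)

IsColNorm : ∀ {k n} → Matrix ℝ k n → ℝ → Set
IsColNorm V = IsMaximum (λ c → ∃[ j ] IsNorm (λ l → V l j) c)

-- IsFactorizationValue M s says that s = ‖U‖row ‖V‖col for some real
-- factorization M = U V, whose inner dimension k is arbitrary.
IsFactorizationValue : ∀ {m n} → Matrix ℝ m n → ℝ → Set
IsFactorizationValue {m} {n} M s =
  ∃[ k ] Σ[ U ∈ Matrix ℝ m k ] Σ[ V ∈ Matrix ℝ k n ]
    (U *ₘ V ≃ₘ M) ×
    ∃[ r ] ∃[ c ] IsRowNorm U r × IsColNorm V c × s ≃ r * c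

-- The relation γ₂(M) = g, which determines g up to _≃_.
Isγ₂ : ∀ {m n} → Matrix ℝ m n → ℝ → Set
Isγ₂ M = IsMinimum (IsFactorizationValue M)

BoolMatrix : ℕ → ℕ → Set
BoolMatrix = Matrix Bool

toReal : ∀ {m n} → BoolMatrix m n → Matrix ℝ m n
toReal M i j = if M i j then 1ℝ else 0ℝ

-- The rows and columns of the submatrix are arbitrary, not necessarily
-- contiguous, sets of size t.
HasAllOnesSubmatrix : ∀ {m n} → ℕ → BoolMatrix m n → Set
HasAllOnesSubmatrix {m} {n} t M =
  Σ[ R ∈ Subset m ] Σ[ C ∈ Subset n ]
    ∣ R ∣ ≡ t × ∣ C ∣ ≡ t × (∀ {i j} → i ∈ R → j ∈ C → M i j ≡ true)

numOnes : ∀ {m n} → BoolMatrix m n → ℕ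
numOnes M = ∑ℕ (λ i → ∑ℕ (λ j → if M i j then 1 else 0))
  where
  ∑ℕ : ∀ {n} → Vector ℕ n → ℕ
  ∑ℕ = monoidSum ℕ.+-0-rawMonoid

{-# OPTIONS --safe #-}

-- Row and column vectors uₓ, v_y with ⟨uₓ , v_y⟩ = Mₓ_y are made rational by evaluating the given
-- factorization at a late index.  If all uₓ, x ∈ X, lie in a ball with centre z and c_y = ⟨z , v_y⟩,
-- then moving z along v_y decreases |uₓ − z|² by a fixed amount on the neighbours of y when
-- c_y ≤ ½, and on the non-neighbours of y when c_y ≥ ½.  In the second case t such columns
-- cover all but fewer than t rows by smaller balls, so after discarding them (and likewise rows)
-- one may assume that the neighbourhoods of the remaining columns y (and rows) span only
-- submatrices that are sparse by induction on the radii.  Then codegrees are small on average,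
-- and with m_y the columns of M, d_y their sums and Q = 1 + Σ_y m_y m_yᵀ / (1 + d_y), this gives m_yᵀ Q⁻¹ m_y ≥ d_y / κ; since
-- m_yᵀ Q⁻¹ m_y = ⟨m_yᵀ Q⁻¹ U , v_y⟩, while Q⁻¹ contracts U, the number of ones is linear.
-- The loads Σ_{y ~ x} 1 / (1 + d_y) needed for this are bounded except on few rows, and if these
-- carry most ones then the roles of rows and columns are exchanged there.

module Submission where

open import Data.Nat.Base as ℕ using (ℕ)
open import Data.Product.Base using (∃-syntax)
open import Relation.Nullary.Negation.Core using (¬_)

-- The proof branches on comparisons (an inner product with `C`, a load with 8, a codegree with 2f).
-- These are decidable over ℚ but not for Cauchy reals, hence the passage to rational vectors.
-- Evaluation at an index gives M only up to an error, while the descent and the quadratic form use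
-- exact inner products, so the error is stored in extra coordinates. U and V can be rescaled
-- against each other, so γ controls only the product RC of the squared norm bounds. Radii are
-- therefore counted in steps of 1/4C, about 4RC in number, and no constant sees R or C alone. The
-- lower bound for τ = mᵀQ⁻¹m is Cauchy-Schwarz, d² ≤ (mᵀQm) τ, where mᵀQm is d plus a weighted sum
-- of squared codegrees, at most κd by sparsity of neighbourhoods. On the other side τ_y = ⟨a_y ,
-- v_y⟩ with a_y = m_yᵀQ⁻¹U, and Σ_y |a_y|² / (1 + d_y) ≤ ¼ Σ_x |u_x|² because Q⁻¹(Q - 1)Q⁻¹ ≤ ¼.
-- AM-GM with the weights 1 + d_y leaves the error term Σ (1 + d_y), which is of the order of the
-- number of ones and is absorbed by a suitable coefficient.

module RationalFactorizations where
  import Data.Bool.Properties as Bool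
  import Data.Fin.Properties as Finₚ
  import Data.Fin.Subset.Properties as Subsetₚ
  import Data.Integer.Base as ℤ
  import Data.Integer.Properties as ℤₚ
  import Data.List.Relation.Unary.All.Properties as Allₚ
  import Data.List.Relation.Unary.Unique.Propositional.Properties as Uniqueₚ
  import Data.Nat.Properties as ℕₚ
  import Data.Rational.Unnormalised.Base as ℚᵘ
  import Data.Rational.Unnormalised.Properties as ℚᵘₚ
  import Defs
  open import Algebra.Definitions.RawMonoid using () renaming (sum to monoidSum)
  open import Data.Bool.Base using (Bool; true; false; if_then_else_)
  open import Data.Fin.Base as Fin using (Fin)
  open import Data.Fin.Subset as Subset using (Subset)
  open import Data.List.Base using (List; []; _∷_; _++_; allFin; filter; length; map; take)
  open import Data.List.Membership.Propositional using (_∈_)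
  open import Data.List.Membership.Propositional.Properties using (∈-filter⁻)
  open import Data.List.Properties using (length-tabulate; length-take; map-tabulate)
  open import Data.List.Relation.Binary.Sublist.Propositional
    using (_⊆_; []; _∷_; _∷ʳ_; ⊆-refl; ⊆-trans; lookup)
  open import Data.List.Relation.Binary.Sublist.Propositional.Properties
    using (All-resp-⊆; filter-⊆)
  open import Data.List.Relation.Unary.All as All using (All; []; _∷_)
  open import Data.List.Relation.Unary.AllPairs using ([]; _∷_)
  open import Data.List.Relation.Unary.Any using (here; there)
  open import Data.List.Relation.Unary.Unique.Propositional using (Unique)
  open import Data.Nat.Base using (zero; suc)
  open import Data.Product.Base using (_×_; _,_; proj₁; proj₂)
  open import Data.Rational.Base
  open import Data.Rational.Properties
  open import Data.Rational.Solver using (module +-*-Solver)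
  open import Data.Sum.Base using (_⊎_; inj₁; inj₂)
  open import Data.Vec.Base as Vec using (_∷_; _[_]≔_)
  open import Data.Vec.Functional using (Vector)
  open import Function.Base using (_∘_; flip; id)
  open import Relation.Binary.PropositionalEquality
    using (_≡_; refl; sym; trans; cong; cong₂; subst; subst₂; module ≡-Reasoning)
  open import Relation.Nullary.Decidable.Core using (Dec; yes; no; does; toWitnessFalse)
  open import Relation.Nullary.Negation.Core using (contradiction)
  open import Relation.Unary using (Decidable)
  open import Relation.Unary.Properties using (∁?)
  open +-*-Solver using (solve; _:+_; _:*_; _:-_; :-_; _:=_; con)
  open Defs using (ℝ; mkℝ; seq; cauchy; IsCauchy; BoolMatrix; HasAllOnesSubmatrix; IsMaximum;
    IsNorm; Isγ₂; numOnes; toReal)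

  private variable
    A B : Set

  -- Ordered-field arithmetic over ℚ

  2ℚ 4ℚ 8ℚ 16ℚ 18ℚ : ℚ
  2ℚ = ℤ.+ 2 / 1
  4ℚ = ℤ.+ 4 / 1
  8ℚ = ℤ.+ 8 / 1
  16ℚ = ℤ.+ 16 / 1
  18ℚ = ℤ.+ 18 / 1

  0≤diff : ∀ {a b} → a ≤ b → 0ℚ ≤ b - a
  0≤diff {a} {b} a≤b = subst (_≤ b - a) (+-inverseʳ a) (+-monoˡ-≤ (- a) a≤b)

  diff≥0⇒≤ : ∀ {b a} → 0ℚ ≤ b - a → a ≤ b
  diff≥0⇒≤ {b} {a} 0≤b-a = subst₂ _≤_ (+-identityˡ a)
    (solve 2 (λ b a → (b :- a) :+ a := b) refl b a) (+-monoˡ-≤ a 0≤b-a)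

  -- Turns an estimate into a certificate: the difference is exhibited as a visibly nonnegative
  -- expression, and the ring solver checks the identity. Most numerical estimates below have this
  -- shape.
  ≤-by : ∀ {a b c} → 0ℚ ≤ c → c ≡ b - a → a ≤ b
  ≤-by 0≤c c≡ = diff≥0⇒≤ (subst (0ℚ ≤_) c≡ 0≤c)

  0≤+ : ∀ {a b} → 0ℚ ≤ a → 0ℚ ≤ b → 0ℚ ≤ a + b
  0≤+ 0≤a 0≤b = +-mono-≤ 0≤a 0≤b

  *-monoˡ-≤ : ∀ {c a b} → 0ℚ ≤ c → a ≤ b → c * a ≤ c * b
  *-monoˡ-≤ {c} 0≤c = *-monoˡ-≤-nonNeg c {{nonNegative 0≤c}}

  *-monoʳ-≤ : ∀ {c a b} → 0ℚ ≤ c → a ≤ b → a * c ≤ b * c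
  *-monoʳ-≤ {c} 0≤c = *-monoʳ-≤-nonNeg c {{nonNegative 0≤c}}

  0≤* : ∀ {a b} → 0ℚ ≤ a → 0ℚ ≤ b → 0ℚ ≤ a * b
  0≤* {a} {b} 0≤a 0≤b = subst (_≤ a * b) (*-zeroʳ a) (*-monoˡ-≤ 0≤a 0≤b)

  *-mono-≤ : ∀ {a b c d} → 0ℚ ≤ a → 0ℚ ≤ d → a ≤ b → c ≤ d → a * c ≤ b * d
  *-mono-≤ 0≤a 0≤d a≤b c≤d = ≤-trans (*-monoˡ-≤ 0≤a c≤d) (*-monoʳ-≤ 0≤d a≤b)

  0<* : ∀ {a b} → 0ℚ < a → 0ℚ < b → 0ℚ < a * b
  0<* {a} {b} 0<a 0<b =
    positive⁻¹ (a * b) {{pos*pos⇒pos a {{positive 0<a}} b {{positive 0<b}}}}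

  0≤² : ∀ a → 0ℚ ≤ a * a
  0≤² a with ≤-total 0ℚ a
  ... | inj₁ 0≤a = 0≤* 0≤a 0≤a
  ... | inj₂ a≤0 = subst (0ℚ ≤_) (solve 1 (λ a → (:- a) :* (:- a) := a :* a) refl a)
    (0≤* (neg-antimono-≤ a≤0) (neg-antimono-≤ a≤0))

  *-cancelˡ-≤ : ∀ {c a b} → 0ℚ < c → c * a ≤ c * b → a ≤ b
  *-cancelˡ-≤ {c} 0<c = *-cancelˡ-≤-pos c {{positive 0<c}}

  p≤p+q : ∀ p {q} → 0ℚ ≤ q → p ≤ p + q
  p≤p+q p {q} 0≤q = subst (_≤ p + q) (+-identityʳ p) (+-monoʳ-≤ p 0≤q)

  p≤q+p : ∀ p {q} → 0ℚ ≤ q → p ≤ q + p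
  p≤q+p p {q} 0≤q = subst (_≤ q + p) (+-identityˡ p) (+-monoˡ-≤ p 0≤q)

  reciprocal : ∀ {a} → 0ℚ < a → ∃[ b ] 0ℚ < b × a * b ≡ 1ℚ
  reciprocal {a} 0<a =
    (1/ a) {{a≢0}} , positive⁻¹ _ {{1/pos⇒pos a {{positive 0<a}}}} , *-inverseʳ a {{a≢0}}
    where
    a≢0 : NonZero a
    a≢0 = pos⇒nonZero a {{positive 0<a}}

  -- Finite rational sums over lists, and inner products

  ∑ : List A → (A → ℚ) → ℚ
  ∑ []       f = 0ℚ
  ∑ (x ∷ xs) f = f x + ∑ xs f

  size : List A → ℚ
  size X = ∑ X (λ _ → 1ℚ)

  ∑-cong : ∀ (X : List A) {f g} → (∀ x → f x ≡ g x) → ∑ X f ≡ ∑ X g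
  ∑-cong []      f≡g = refl
  ∑-cong (x ∷ X) f≡g = cong₂ _+_ (f≡g x) (∑-cong X f≡g)

  ∑-mono : ∀ (X : List A) {f g} → (∀ {x} → x ∈ X → f x ≤ g x) → ∑ X f ≤ ∑ X g
  ∑-mono []      f≤g = ≤-refl
  ∑-mono (x ∷ X) f≤g = +-mono-≤ (f≤g (here refl)) (∑-mono X (λ x∈X → f≤g (there x∈X)))

  ∑-zero : ∀ (X : List A) → ∑ X (λ _ → 0ℚ) ≡ 0ℚ
  ∑-zero []      = refl
  ∑-zero (x ∷ X) = trans (+-identityˡ _) (∑-zero X)

  ∑-nonneg : ∀ (X : List A) {f} → (∀ {x} → x ∈ X → 0ℚ ≤ f x) → 0ℚ ≤ ∑ X f
  ∑-nonneg X {f} 0≤f = subst (_≤ ∑ X f) (∑-zero X) (∑-mono X 0≤f)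

  ∑-+ : ∀ (X : List A) f g → ∑ X (λ x → f x + g x) ≡ ∑ X f + ∑ X g
  ∑-+ []      f g = refl
  ∑-+ (x ∷ X) f g = trans (cong ((f x + g x) +_) (∑-+ X f g))
    (solve 4 (λ a b c d → a :+ b :+ (c :+ d) := a :+ c :+ (b :+ d)) refl (f x) (g x) _ _)

  ∑-*ˡ : ∀ (X : List A) c f → ∑ X (λ x → c * f x) ≡ c * ∑ X f
  ∑-*ˡ []      c f = sym (*-zeroʳ c)
  ∑-*ˡ (x ∷ X) c f = trans (cong ((c * f x) +_) (∑-*ˡ X c f)) (sym (*-distribˡ-+ c (f x) (∑ X f)))

  ∑-*ʳ : ∀ (X : List A) c f → ∑ X (λ x → f x * c) ≡ ∑ X f * c
  ∑-*ʳ X c f = trans (∑-cong X (λ x → *-comm (f x) c)) (trans (∑-*ˡ X c f) (*-comm c _))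

  ∑-- : ∀ (X : List A) f g → ∑ X (λ x → f x - g x) ≡ ∑ X f - ∑ X g
  ∑-- []      f g = refl
  ∑-- (x ∷ X) f g = trans (cong ((f x - g x) +_) (∑-- X f g))
    (solve 4 (λ a b c d → a :- b :+ (c :- d) := a :+ c :- (b :+ d)) refl (f x) (g x) _ _)

  ∑-const : ∀ (X : List A) c → ∑ X (λ _ → c) ≡ size X * c
  ∑-const X c = trans (∑-cong X (λ _ → sym (*-identityˡ c))) (∑-*ʳ X c _)

  ∑-swap : ∀ (X : List A) (Y : List B) (f : A → B → ℚ) →
    ∑ X (λ x → ∑ Y (λ y → f x y)) ≡ ∑ Y (λ y → ∑ X (λ x → f x y))
  ∑-swap []      Y f = sym (∑-zero Y)
  ∑-swap (x ∷ X) Y f = trans (cong (∑ Y (f x) +_) (∑-swap X Y f))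
    (sym (∑-+ Y (f x) (λ y → ∑ X (λ x → f x y))))

  ∑-++ : ∀ (X Y : List A) f → ∑ (X ++ Y) f ≡ ∑ X f + ∑ Y f
  ∑-++ []      Y f = sym (+-identityˡ _)
  ∑-++ (x ∷ X) Y f = trans (cong (f x +_) (∑-++ X Y f)) (sym (+-assoc (f x) _ _))

  ∑-map : ∀ (h : A → B) X f → ∑ (map h X) f ≡ ∑ X (λ x → f (h x))
  ∑-map h []      f = refl
  ∑-map h (x ∷ X) f = cong (f (h x) +_) (∑-map h X f)

  ∑-split : ∀ {P : A → Set} (P? : Decidable P) X f →
    ∑ X f ≡ ∑ (filter P? X) f + ∑ (filter (∁? P?) X) f
  ∑-split P? []      f = refl
  ∑-split P? (x ∷ X) f with P? x
  ... | yes _ = trans (cong (f x +_) (∑-split P? X f)) (sym (+-assoc (f x) _ _))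
  ... | no _  = trans (cong (f x +_) (∑-split P? X f))
    (solve 3 (λ a b c → a :+ (b :+ c) := b :+ (a :+ c)) refl (f x) (∑ (filter P? X) f) (∑ (filter (∁? P?) X) f))

  size-nonneg : (X : List A) → 0ℚ ≤ size X
  size-nonneg X = ∑-nonneg X (λ _ → nonNegative⁻¹ 1ℚ)

  dot : ∀ {A : Set} → List A → (A → ℚ) → (A → ℚ) → ℚ
  dot X f g = ∑ X (λ x → f x * g x)

  dot-comm : ∀ {A : Set} (X : List A) f g → dot X f g ≡ dot X g f
  dot-comm X f g = ∑-cong X (λ x → *-comm (f x) (g x))

  dot-congʳ : ∀ {A : Set} (X : List A) f {g h} → (∀ x → g x ≡ h x) → dot X f g ≡ dot X f h
  dot-congʳ X f g≡h = ∑-cong X (λ x → cong (f x *_) (g≡h x))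

  dot-subʳ : ∀ {A : Set} (X : List A) f g c h →
    dot X f (λ x → g x - c * h x) ≡ dot X f g - c * dot X f h
  dot-subʳ X f g c h = begin
    dot X f (λ x → g x - c * h x)
      ≡⟨ ∑-cong X (λ x → solve 4 (λ f g c h → f :* (g :- c :* h) := f :* g :- c :* (f :* h))
           refl (f x) (g x) c (h x)) ⟩
    ∑ X (λ x → f x * g x - c * (f x * h x))
      ≡⟨ ∑-- X (λ x → f x * g x) (λ x → c * (f x * h x)) ⟩
    dot X f g - ∑ X (λ x → c * (f x * h x))
      ≡⟨ cong (λ s → dot X f g - s) (∑-*ˡ X c (λ x → f x * h x)) ⟩
    dot X f g - c * dot X f h ∎
    where open ≡-Reasoning

  dot-subˡ : ∀ {A : Set} (X : List A) f c h g →
    dot X (λ x → f x - c * h x) g ≡ dot X f g - c * dot X h g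
  dot-subˡ X f c h g = trans (dot-comm X _ g) (trans (dot-subʳ X g f c h)
    (cong₂ (λ s t → s - c * t) (dot-comm X g f) (dot-comm X g h)))

  -- The operator Q = 1 + Σ ω_y m_y m_yᵀ and its quadratic form

  module RankOneUpdates {A B : Set} (X : List A) (μ : A → B → ℚ)
    (ω : B → ℚ) (0≤ω : ∀ y → 0ℚ ≤ ω y) where

    col : B → A → ℚ
    col y x = μ x y

    -- Q applied to w; `form` below is gᵀQh. The inverse of Q occurs only through solutions w of
    -- `op Y w x ≡ b x`.
    op : List B → (A → ℚ) → A → ℚ
    op Y w x = w x + ∑ Y (λ y → ω y * dot X (col y) w * μ x y)

    form : List B → (A → ℚ) → (A → ℚ) → ℚ
    form Y g h = dot X g h + ∑ Y (λ y → ω y * (dot X (col y) g * dot X (col y) h))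

    form-comm : ∀ Y g h → form Y g h ≡ form Y h g
    form-comm Y g h = cong₂ _+_ (dot-comm X g h)
      (∑-cong Y (λ y → cong (ω y *_) (*-comm (dot X (col y) g) (dot X (col y) h))))

    form-nonneg : ∀ Y g → 0ℚ ≤ form Y g g
    form-nonneg Y g = 0≤+ (∑-nonneg X (λ {x} _ → 0≤² (g x)))
      (∑-nonneg Y (λ {y} _ → 0≤* (0≤ω y) (0≤² (dot X (col y) g))))

    dot-op : ∀ Y g h → dot X g (op Y h) ≡ form Y g h
    dot-op Y g h = begin
      dot X g (op Y h)
        ≡⟨ ∑-cong X (λ x → *-distribˡ-+ (g x) (h x) _) ⟩
      ∑ X (λ x → g x * h x + g x * ∑ Y (λ y → ω y * c y * μ x y))
        ≡⟨ ∑-+ X (λ x → g x * h x) _ ⟩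
      dot X g h + ∑ X (λ x → g x * ∑ Y (λ y → ω y * c y * μ x y))
        ≡⟨ cong (dot X g h +_) (∑-cong X (λ x → ∑-*ˡ Y (g x) _)) ⟨
      dot X g h + ∑ X (λ x → ∑ Y (λ y → g x * (ω y * c y * μ x y)))
        ≡⟨ cong (dot X g h +_) (∑-swap X Y _) ⟩
      dot X g h + ∑ Y (λ y → ∑ X (λ x → g x * (ω y * c y * μ x y)))
        ≡⟨ cong (dot X g h +_) (∑-cong Y λ y → begin
             ∑ X (λ x → g x * (ω y * c y * μ x y))
               ≡⟨ ∑-cong X (λ x → solve 3 (λ g k m → g :* (k :* m) := k :* (m :* g))
                    refl (g x) (ω y * c y) (μ x y)) ⟩
             ∑ X (λ x → ω y * c y * (μ x y * g x))
               ≡⟨ ∑-*ˡ X (ω y * c y) _ ⟩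
             ω y * c y * dot X (col y) g
               ≡⟨ solve 3 (λ w c d → w :* c :* d := w :* (d :* c)) refl (ω y) (c y) _ ⟩
             ω y * (dot X (col y) g * c y) ∎) ⟩
      form Y g h ∎
      where
      open ≡-Reasoning
      c : B → ℚ
      c y = dot X (col y) h

    op-sub : ∀ Y f c h x → op Y (λ x → f x - c * h x) x ≡ op Y f x - c * op Y h x
    op-sub Y f c h x = begin
      f x - c * h x + ∑ Y (λ y → ω y * dot X (col y) (λ x → f x - c * h x) * μ x y)
        ≡⟨ cong ((f x - c * h x) +_) (∑-cong Y λ y →
             trans (cong (λ s → ω y * s * μ x y) (dot-subʳ X (col y) f c h))
               (solve 5 (λ w a c b m → w :* (a :- c :* b) :* m := w :* a :* m :- c :* (w :* b :* m))
                 refl (ω y) (dot X (col y) f) c (dot X (col y) h) (μ x y))) ⟩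
      f x - c * h x + ∑ Y (λ y → ω y * dot X (col y) f * μ x y - c * (ω y * dot X (col y) h * μ x y))
        ≡⟨ cong ((f x - c * h x) +_) (trans (∑-- Y _ _) (cong (λ s → F - s) (∑-*ˡ Y c _))) ⟩
      f x - c * h x + (F - c * H)
        ≡⟨ solve 5 (λ f c h F H → f :- c :* h :+ (F :- c :* H) := f :+ F :- c :* (h :+ H))
             refl (f x) c (h x) F H ⟩
      op Y f x - c * op Y h x ∎
      where
      open ≡-Reasoning
      F H : ℚ
      F = ∑ Y (λ y → ω y * dot X (col y) f * μ x y)
      H = ∑ Y (λ y → ω y * dot X (col y) h * μ x y)

    -- The Sherman–Morrison formula, one column at a time.
    op-surjective : ∀ Y b → ∃[ w ] (∀ x → op Y w x ≡ b x)
    op-surjective []      b = b , λ x → +-identityʳ (b x)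
    op-surjective (y ∷ Y) b =
      let f , op-f = op-surjective Y b
          h , op-h = op-surjective Y (col y)
          α = dot X (col y) f
          β = dot X (col y) h
          -- β = hᵀQh for the solution h of Qh = m_y, so the Sherman-Morrison denominator 1 + ωβ is
          -- at least 1.
          0≤β = subst (0ℚ ≤_)
            (trans (sym (dot-op Y h h)) (trans (dot-congʳ X h op-h) (dot-comm X h (col y))))
            (form-nonneg Y h)
          r , _ , [1+ωβ]r≡1 = reciprocal {1ℚ + ω y * β}
            (<-≤-trans (positive⁻¹ 1ℚ) (subst (_≤ 1ℚ + ω y * β) (+-identityʳ 1ℚ)
              (+-monoʳ-≤ 1ℚ (0≤* (0≤ω y) 0≤β))))
          c = r * (ω y * α)
          w : A → ℚ
          w x = f x - c * h x
      in w , λ x →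
        let open ≡-Reasoning
            S = ∑ Y (λ y → ω y * dot X (col y) w * μ x y)
        in begin
        w x + (ω y * dot X (col y) w * μ x y + S)
          ≡⟨ solve 3 (λ a b c → a :+ (b :+ c) := (a :+ c) :+ b) refl (w x) _ S ⟩
        op Y w x + ω y * dot X (col y) w * μ x y
          ≡⟨ cong₂ (λ s t → s + ω y * t * μ x y)
               (trans (op-sub Y f c h x) (cong₂ (λ s t → s - c * t) (op-f x) (op-h x)))
               (dot-subʳ X (col y) f c h) ⟩
        b x - c * μ x y + ω y * (α - c * β) * μ x y
          ≡⟨ solve 6 (λ b r w α β m →
               b :- r :* (w :* α) :* m :+ w :* (α :- r :* (w :* α) :* β) :* m :=
               b :+ w :* α :* m :* (con 1ℚ :- (con 1ℚ :+ w :* β) :* r))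
               refl (b x) r (ω y) α β (μ x y) ⟩
        b x + ω y * α * μ x y * (1ℚ - (1ℚ + ω y * β) * r)
          ≡⟨ cong (λ s → b x + ω y * α * μ x y * (1ℚ - s)) [1+ωβ]r≡1 ⟩
        b x + ω y * α * μ x y * (1ℚ - 1ℚ)
          ≡⟨ solve 2 (λ b k → b :+ k :* con 0ℚ := b) refl (b x) (ω y * α * μ x y) ⟩
        b x ∎

    -- The sum is wᵀQw - |w|² = ⟨w , u⟩ - |w|², and 4(wu - w²) ≤ u² in each coordinate because (u -
    -- 2w)² ≥ 0.
    op-bound : ∀ Y {w u} → (∀ x → op Y w x ≡ u x) →
      4ℚ * ∑ Y (λ y → ω y * (dot X (col y) w * dot X (col y) w)) ≤ dot X u u
    op-bound Y {w} {u} op-w = begin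
      4ℚ * s
        ≡⟨ cong (4ℚ *_) (solve 2 (λ a s → s := a :+ s :- a) refl (dot X w w) s) ⟩
      4ℚ * (form Y w w - dot X w w)
        ≡⟨ cong (λ t → 4ℚ * (t - dot X w w)) (trans (sym (dot-op Y w w)) (dot-congʳ X w op-w)) ⟩
      4ℚ * (dot X w u - dot X w w)
        ≡⟨ trans (cong (4ℚ *_) (sym (∑-- X _ _))) (sym (∑-*ˡ X 4ℚ _)) ⟩
      ∑ X (λ x → 4ℚ * (w x * u x - w x * w x))
        ≤⟨ ∑-mono X (λ {x} _ → ≤-by (0≤² (u x - 2ℚ * w x))
             (solve 2 (λ u w → (u :- con 2ℚ :* w) :* (u :- con 2ℚ :* w) :=
                               u :* u :- con 4ℚ :* (w :* u :- w :* w)) refl (u x) (w x))) ⟩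
      dot X u u ∎
      where
      open ≤-Reasoning
      s : ℚ
      s = ∑ Y (λ y → ω y * (dot X (col y) w * dot X (col y) w))

    -- Cauchy–Schwarz for the form, in the shape 0 ≤ form (m − κ g) (m − κ g) with m = col y.
    op-inverse-bound : ∀ Y y {g κ} → 0ℚ < κ → (∀ x → op Y g x ≡ col y x) →
      form Y (col y) (col y) ≤ κ * dot X (col y) (col y) →
      dot X (col y) (col y) ≤ κ * dot X g (col y)
    op-inverse-bound Y y {g} {κ} 0<κ op-g form≤ =
      -- With q = mᵀQm, the form of p is q - 2κd + κ²τ; adding κd - q ≥ 0 leaves κ(κτ - d), and κ is
      -- cancelled.
      *-cancelˡ-≤ 0<κ (≤-by (0≤+ (form-nonneg Y p) (0≤diff form≤))
        (trans (cong (_+ (κ * d - form Y m m)) form-p)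
          (solve 4 (λ q k d t → q :- k :* d :- k :* (d :- k :* t) :+ (k :* d :- q) :=
                                k :* (k :* t) :- k :* d) refl (form Y m m) κ d τ)))
      where
      open ≡-Reasoning
      m p : A → ℚ
      m = col y
      p x = m x - κ * g x
      d τ : ℚ
      d = dot X m m
      τ = dot X g m
      op-p : ∀ x → op Y p x ≡ op Y m x - κ * m x
      op-p x = trans (op-sub Y m κ g x) (cong (λ s → op Y m x - κ * s) (op-g x))
      form-p : form Y p p ≡ form Y m m - κ * d - κ * (d - κ * τ)
      form-p = begin
        form Y p p                     ≡⟨ dot-op Y p p ⟨
        dot X p (op Y p)               ≡⟨ dot-congʳ X p op-p ⟩
        dot X p (λ x → op Y m x - κ * m x)
          ≡⟨ dot-subʳ X p (op Y m) κ m ⟩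
        dot X p (op Y m) - κ * dot X p m
          ≡⟨ cong₂ (λ s t → s - κ * t) (dot-subˡ X m κ g (op Y m)) (dot-subˡ X m κ g m) ⟩
        dot X m (op Y m) - κ * dot X g (op Y m) - κ * (d - κ * τ)
          ≡⟨ cong₂ (λ s t → s - κ * t - κ * (d - κ * τ)) (dot-op Y m m)
               (trans (dot-op Y g m) (trans (form-comm Y g m)
                 (trans (sym (dot-op Y m g)) (dot-congʳ X m op-g)))) ⟩
        form Y m m - κ * d - κ * (d - κ * τ) ∎

  -- Bounding the degree sum through a factorization

  module Factorization {A B L : Set} (ls : List L) (μ : A → B → ℚ)
    (u : A → L → ℚ) (v : B → L → ℚ) (uv≡μ : ∀ x y → dot ls (u x) (v y) ≡ μ x y)
    (R C : ℚ) (0<C : 0ℚ < C)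
    (∣u∣²≤R : ∀ x → dot ls (u x) (u x) ≤ R) (∣v∣²≤C : ∀ y → dot ls (v y) (v y) ≤ C)
    where

    module _ (X : List A) (Y : List B) (ω θ : B → ℚ)
      (0≤ω : ∀ y → 0ℚ ≤ ω y) (0≤θ : ∀ y → 0ℚ ≤ θ y) (θω≡1 : ∀ y → θ y * ω y ≡ 1ℚ)
      (κ : ℚ) (0<κ : 0ℚ < κ)
      where
      open RankOneUpdates X μ ω 0≤ω

      private
        -- `W l` is the l-th column of Q⁻¹U; accordingly `a y` is the vector m_yᵀQ⁻¹U.
        W : L → A → ℚ
        W l = proj₁ (op-surjective Y (λ x → u x l))

        op-W : ∀ l x → op Y (W l) x ≡ u x l
        op-W l = proj₂ (op-surjective Y (λ x → u x l))

        a : B → L → ℚ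
        a y l = dot X (col y) (W l)

        -- With g = Q⁻¹m_y, expand m_y = U v_y coordinate by coordinate, then move Q from `W l` to g
        -- by symmetry of the form.
        τ-as-dot : ∀ y {g} → (∀ x → op Y g x ≡ col y x) → dot X g (col y) ≡ dot ls (v y) (a y)
        τ-as-dot y {g} op-g = begin
          dot X g (col y)
            ≡⟨ dot-congʳ X g (λ x → sym (uv≡μ x y)) ⟩
          ∑ X (λ x → g x * ∑ ls (λ l → u x l * v y l))
            ≡⟨ ∑-cong X (λ x → sym (∑-*ˡ ls (g x) _)) ⟩
          ∑ X (λ x → ∑ ls (λ l → g x * (u x l * v y l)))
            ≡⟨ ∑-swap X ls _ ⟩
          ∑ ls (λ l → ∑ X (λ x → g x * (u x l * v y l)))
            ≡⟨ ∑-cong ls (λ l → trans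
                 (∑-cong X (λ x → solve 3 (λ g u v → g :* (u :* v) := v :* (g :* u))
                   refl (g x) (u x l) (v y l)))
                 (∑-*ˡ X (v y l) _)) ⟩
          ∑ ls (λ l → v y l * dot X g (λ x → u x l))
            ≡⟨ dot-congʳ ls (v y) (λ l → begin
                 dot X g (λ x → u x l)  ≡⟨ dot-congʳ X g (op-W l) ⟨
                 dot X g (op Y (W l))   ≡⟨ dot-op Y g (W l) ⟩
                 form Y g (W l)         ≡⟨ form-comm Y g (W l) ⟩
                 form Y (W l) g         ≡⟨ dot-op Y (W l) g ⟨
                 dot X (W l) (op Y g)   ≡⟨ dot-congʳ X (W l) op-g ⟩
                 dot X (W l) (col y)    ≡⟨ dot-comm X (W l) (col y) ⟩
                 a y l                  ∎) ⟩
          dot ls (v y) (a y) ∎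
          where open ≡-Reasoning

        K : ℚ
        K = κ * C

        -- Completing the square in θ(s - 8Kωt)² splits 16K⟨v y , a y⟩ into two parts that can be
        -- summed over y: the part with `a y` carries the factor 4ω that `op-bound` consumes, and
        -- the part with `v y` adds up to CΣθ. The factor 16 on the left keeps Σθ small enough to be
        -- absorbed later.
        column-bound : ∀ y → form Y (col y) (col y) ≤ κ * dot X (col y) (col y) →
          16ℚ * C * dot X (col y) (col y) ≤
          16ℚ * (K * K) * (4ℚ * (ω y * dot ls (a y) (a y))) + C * θ y
        column-bound y form≤ = begin
          16ℚ * C * d
            ≤⟨ *-monoˡ-≤ (0≤* (nonNegative⁻¹ 16ℚ) (<⇒≤ 0<C)) (op-inverse-bound Y y {g} 0<κ op-g form≤) ⟩
          16ℚ * C * (κ * dot X g (col y))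
            ≡⟨ cong (λ s → 16ℚ * C * (κ * s)) (τ-as-dot y {g} op-g) ⟩
          16ℚ * C * (κ * dot ls (v y) (a y))
            ≡⟨ trans (solve 3 (λ C κ s → con 16ℚ :* C :* (κ :* s) := con 16ℚ :* (κ :* C) :* s)
                 refl C κ (dot ls (v y) (a y))) (sym (∑-*ˡ ls (16ℚ * K) _)) ⟩
          ∑ ls (λ l → 16ℚ * K * (v y l * a y l))
            ≤⟨ ∑-mono ls (λ {l} _ → weighted-AM-GM (v y l) (a y l)) ⟩
          ∑ ls (λ l → 16ℚ * (K * K) * (4ℚ * ω y) * (a y l * a y l) + θ y * (v y l * v y l))
            ≡⟨ trans (∑-+ ls _ _) (cong₂ _+_ (∑-*ˡ ls (16ℚ * (K * K) * (4ℚ * ω y)) _) (∑-*ˡ ls (θ y) _)) ⟩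
          16ℚ * (K * K) * (4ℚ * ω y) * dot ls (a y) (a y) + θ y * dot ls (v y) (v y)
            ≤⟨ +-monoʳ-≤ (16ℚ * (K * K) * (4ℚ * ω y) * dot ls (a y) (a y)) (*-monoˡ-≤ (0≤θ y) (∣v∣²≤C y)) ⟩
          16ℚ * (K * K) * (4ℚ * ω y) * dot ls (a y) (a y) + θ y * C
            ≡⟨ solve 5 (λ K w s t C → con 16ℚ :* K :* (con 4ℚ :* w) :* s :+ t :* C :=
                                      con 16ℚ :* K :* (con 4ℚ :* (w :* s)) :+ C :* t)
                 refl (K * K) (ω y) (dot ls (a y) (a y)) (θ y) C ⟩
          16ℚ * (K * K) * (4ℚ * (ω y * dot ls (a y) (a y))) + C * θ y ∎
          where
          open ≤-Reasoning
          g : A → ℚ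
          g = proj₁ (op-surjective Y (col y))
          op-g : ∀ x → op Y g x ≡ col y x
          op-g = proj₂ (op-surjective Y (col y))
          d : ℚ
          d = dot X (col y) (col y)
          weighted-AM-GM : ∀ s t →
            16ℚ * K * (s * t) ≤ 16ℚ * (K * K) * (4ℚ * ω y) * (t * t) + θ y * (s * s)
          weighted-AM-GM s t = ≤-by (0≤* (0≤θ y) (0≤² (s - 8ℚ * K * ω y * t)))
            (trans (solve 5 (λ s t K w h →
                h :* ((s :- con 8ℚ :* K :* w :* t) :* (s :- con 8ℚ :* K :* w :* t)) :=
                con 16ℚ :* (K :* K) :* (con 4ℚ :* w :* (h :* w)) :* (t :* t) :+ h :* (s :* s)
                  :- con 16ℚ :* K :* (h :* w) :* (s :* t)) refl s t K (ω y) (θ y))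
              (trans (cong (λ r → 16ℚ * (K * K) * (4ℚ * ω y * r) * (t * t) + θ y * (s * s)
                       - 16ℚ * K * r * (s * t)) (θω≡1 y))
                (solve 5 (λ s t K w h →
                  con 16ℚ :* (K :* K) :* (con 4ℚ :* w :* con 1ℚ) :* (t :* t) :+ h :* (s :* s)
                    :- con 16ℚ :* K :* con 1ℚ :* (s :* t) :=
                  con 16ℚ :* (K :* K) :* (con 4ℚ :* w) :* (t :* t) :+ h :* (s :* s)
                    :- con 16ℚ :* K :* (s :* t)) refl s t K (ω y) (θ y))))

      degree-sum-bound :
        (∀ {y} → y ∈ Y → form Y (col y) (col y) ≤ κ * dot X (col y) (col y)) →
        16ℚ * ∑ Y (λ y → dot X (col y) (col y)) ≤ 16ℚ * (κ * κ) * (R * C) * size X + ∑ Y θ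
      degree-sum-bound form≤ = *-cancelˡ-≤ 0<C (begin
        C * (16ℚ * ∑ Y d)
          ≡⟨ solve 2 (λ C s → C :* (con 16ℚ :* s) := con 16ℚ :* C :* s) refl C (∑ Y d) ⟩
        16ℚ * C * ∑ Y d
          ≡⟨ ∑-*ˡ Y (16ℚ * C) d ⟨
        ∑ Y (λ y → 16ℚ * C * d y)
          ≤⟨ ∑-mono Y (λ {y} y∈Y → column-bound y (form≤ y∈Y)) ⟩
        ∑ Y (λ y → 16ℚ * (K * K) * (4ℚ * (ω y * dot ls (a y) (a y))) + C * θ y)
          ≡⟨ trans (∑-+ Y _ _) (cong₂ _+_
               (trans (∑-*ˡ Y (16ℚ * (K * K)) _) (cong (16ℚ * (K * K) *_) (∑-*ˡ Y 4ℚ _)))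
               (∑-*ˡ Y C θ)) ⟩
        16ℚ * (K * K) * (4ℚ * ∑ Y (λ y → ω y * dot ls (a y) (a y))) + C * ∑ Y θ
          ≡⟨ cong (λ s → 16ℚ * (K * K) * s + C * ∑ Y θ) by-coordinates ⟩
        16ℚ * (K * K) * ∑ ls (λ l → 4ℚ * ∑ Y (λ y → ω y * (a y l * a y l))) + C * ∑ Y θ
          ≤⟨ +-monoˡ-≤ (C * ∑ Y θ) (*-monoˡ-≤ (0≤* (nonNegative⁻¹ 16ℚ) (0≤² K))
               (∑-mono ls (λ {l} _ → op-bound Y (op-W l)))) ⟩
        16ℚ * (K * K) * ∑ ls (λ l → dot X (λ x → u x l) (λ x → u x l)) + C * ∑ Y θ
          ≡⟨ cong (λ s → 16ℚ * (K * K) * s + C * ∑ Y θ) (∑-swap ls X _) ⟩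
        16ℚ * (K * K) * ∑ X (λ x → dot ls (u x) (u x)) + C * ∑ Y θ
          ≤⟨ +-monoˡ-≤ (C * ∑ Y θ) (*-monoˡ-≤ (0≤* (nonNegative⁻¹ 16ℚ) (0≤² K))
               (∑-mono X (λ {x} _ → ∣u∣²≤R x))) ⟩
        16ℚ * (K * K) * ∑ X (λ _ → R) + C * ∑ Y θ
          ≡⟨ cong (λ s → 16ℚ * (K * K) * s + C * ∑ Y θ) (∑-const X R) ⟩
        16ℚ * (K * K) * (size X * R) + C * ∑ Y θ
          ≡⟨ solve 5 (λ κ C n R t → con 16ℚ :* (κ :* C :* (κ :* C)) :* (n :* R) :+ C :* t :=
                                    C :* (con 16ℚ :* (κ :* κ) :* (R :* C) :* n :+ t))
               refl κ C (size X) R (∑ Y θ) ⟩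
        C * (16ℚ * (κ * κ) * (R * C) * size X + ∑ Y θ) ∎)
        where
        open ≤-Reasoning
        d : B → ℚ
        d y = dot X (col y) (col y)
        by-coordinates : 4ℚ * ∑ Y (λ y → ω y * dot ls (a y) (a y)) ≡
                         ∑ ls (λ l → 4ℚ * ∑ Y (λ y → ω y * (a y l * a y l)))
        by-coordinates = trans (cong (4ℚ *_) (trans
          (∑-cong Y (λ y → sym (∑-*ˡ ls (ω y) _)))
          (∑-swap Y ls _))) (sym (∑-*ˡ ls 4ℚ _))

  -- Locally sparse pairs of sets of rows and columns

  ind : Bool → ℚ
  ind true  = 1ℚ
  ind false = 0ℚ

  0≤ind : ∀ b → 0ℚ ≤ ind b
  0≤ind true  = nonNegative⁻¹ 1ℚ
  0≤ind false = ≤-refl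

  ind≤1 : ∀ b → ind b ≤ 1ℚ
  ind≤1 true  = ≤-refl
  ind≤1 false = nonNegative⁻¹ 1ℚ

  ind-idem : ∀ b → ind b * ind b ≡ ind b
  ind-idem true  = refl
  ind-idem false = refl

  ∑-filter : ∀ (b : A → Bool) X f →
    ∑ (filter (λ x → b x Bool.≟ true) X) f ≡ ∑ X (λ x → ind (b x) * f x)
  ∑-filter b []      f = refl
  ∑-filter b (x ∷ X) f with b x
  ... | true  = cong₂ _+_ (sym (*-identityˡ (f x))) (∑-filter b X f)
  ... | false = trans (∑-filter b X f)
    (solve 2 (λ f s → s := con 0ℚ :* f :+ s) refl (f x) (∑ X (λ x → ind (b x) * f x)))

  ∑-⊆ : ∀ {X′ X : List A} {f} → (∀ x → 0ℚ ≤ f x) → X′ ⊆ X → ∑ X′ f ≤ ∑ X f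
  ∑-⊆ 0≤f [] = ≤-refl
  ∑-⊆ {f = f} 0≤f (x ∷ʳ X′⊆X) = subst (_≤ _) (+-identityˡ _) (+-mono-≤ (0≤f x) (∑-⊆ 0≤f X′⊆X))
  ∑-⊆ {f = f} 0≤f (_∷_ {x} refl X′⊆X) = +-monoʳ-≤ (f x) (∑-⊆ 0≤f X′⊆X)

  size-⊆ : {X′ X : List A} → X′ ⊆ X → size X′ ≤ size X
  size-⊆ = ∑-⊆ (λ _ → nonNegative⁻¹ 1ℚ)

  edges : (A → B → Bool) → List A → List B → ℚ
  edges M X Y = ∑ X (λ x → ∑ Y (λ y → ind (M x y)))

  degree : (A → B → Bool) → List A → B → ℚ
  degree M X y = ∑ X (λ x → ind (M x y))

  degree-nonneg : ∀ (M : A → B → Bool) X y → 0ℚ ≤ degree M X y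
  degree-nonneg M X y = ∑-nonneg X (λ {x} _ → 0≤ind (M x y))

  edges-flip : ∀ (M : A → B → Bool) X Y → edges M X Y ≡ edges (flip M) Y X
  edges-flip M X Y = ∑-swap X Y (λ x y → ind (M x y))

  edges-nonneg : ∀ (M : A → B → Bool) X Y → 0ℚ ≤ edges M X Y
  edges-nonneg M X Y = ∑-nonneg X (λ {x} _ → degree-nonneg (flip M) Y x)

  edges-splitʳ : ∀ (M : A → B → Bool) {P : B → Set} (P? : Decidable P) X Y →
    edges M X Y ≡ edges M X (filter P? Y) + edges M X (filter (∁? P?) Y)
  edges-splitʳ M P? X Y = trans (∑-cong X (λ x → ∑-split P? Y (λ y → ind (M x y)))) (∑-+ X _ _)

  edges-⊆ˡ : ∀ (M : A → B → Bool) {X′ X} Y → X′ ⊆ X → edges M X′ Y ≤ edges M X Y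
  edges-⊆ˡ M Y = ∑-⊆ (degree-nonneg (flip M) Y)

  -- R and C bound squared norms, so Γ plays the role of the square of γ₂. The coordinate type is
  -- left free so that an error block can be appended as a sum type.
  record BoundedFactorization {A B : Set} (M : A → B → Bool) (Γ : ℚ) : Set₁ where
    field
      {Coordinate} : Set
      coordinates : List Coordinate
      u : A → Coordinate → ℚ
      v : B → Coordinate → ℚ
      uv≡M : ∀ x y → dot coordinates (u x) (v y) ≡ ind (M x y)
      R C : ℚ
      0<R : 0ℚ < R
      0<C : 0ℚ < C
      ∣u∣²≤R : ∀ x → dot coordinates (u x) (u x) ≤ R
      ∣v∣²≤C : ∀ y → dot coordinates (v y) (v y) ≤ C
      RC≤Γ : R * C ≤ Γ

  transpose : ∀ {M : A → B → Bool} {Γ} →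
    BoundedFactorization M Γ → BoundedFactorization (flip M) Γ
  transpose {Γ = Γ} φ = record
    { coordinates = coordinates
    ; u = v ; v = u
    ; uv≡M = λ y x → trans (dot-comm coordinates (v y) (u x)) (uv≡M x y)
    ; R = C ; C = R ; 0<R = 0<C ; 0<C = 0<R ; ∣u∣²≤R = ∣v∣²≤C ; ∣v∣²≤C = ∣u∣²≤R
    ; RC≤Γ = subst (_≤ Γ) (*-comm R C) RC≤Γ
    }
    where open BoundedFactorization φ

  -- Ranging over all subsets makes the condition hereditary, and allows Y′ to be chosen as the
  -- columns that share many rows with y.
  LocallySparse : (A → B → Bool) → ℚ → List A → List B → Set
  LocallySparse M f X Y = ∀ {X′ Y′ y} → X′ ⊆ X → Y′ ⊆ Y → y ∈ Y →
    All (λ x → M x y ≡ true) X′ → edges M X′ Y′ ≤ f * (size X′ + size Y′)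

  locallySparse-⊆ : ∀ (M : A → B → Bool) f {X′ X Y′ Y} → X′ ⊆ X → Y′ ⊆ Y →
    LocallySparse M f X Y → LocallySparse M f X′ Y′
  locallySparse-⊆ M f X′⊆X Y′⊆Y sparse X″⊆X′ Y″⊆Y′ y∈Y′ =
    sparse (⊆-trans X″⊆X′ X′⊆X) (⊆-trans Y″⊆Y′ Y′⊆Y) (lookup Y′⊆Y y∈Y′)

  -- The ratio bound for mᵀQm against d: 1 from |m|² = d, 2f from the columns of codegree above 2f,
  -- and 2f · 8 from the others, 8 being the bound on loads.
  κ : ℚ → ℚ
  κ f = 1ℚ + 18ℚ * f

  -- D only dominates the degree in X: the weights are fixed before heavy rows are removed, since
  -- weights recomputed from the smaller degrees would raise the loads again.
  module _ {M : A → B → Bool} {Γ f : ℚ} (φ : BoundedFactorization M Γ) (0≤f : 0ℚ ≤ f)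
    (X : List A) (Y : List B) (D ω : B → ℚ)
    (0≤D : ∀ y → 0ℚ ≤ D y) (0≤ω : ∀ y → 0ℚ ≤ ω y) ([1+D]ω≡1 : ∀ y → (1ℚ + D y) * ω y ≡ 1ℚ)
    (degree≤D : ∀ y → degree M X y ≤ D y)
    (load≤8 : ∀ {x} → x ∈ X → ∑ Y (λ y → ω y * ind (M x y)) ≤ 8ℚ)
    (sparse : LocallySparse M f X Y)
    where
    open BoundedFactorization φ
    open RankOneUpdates X (λ x y → ind (M x y)) ω 0≤ω using (col; form)

    private
      dot-col : ∀ y → dot X (col y) (col y) ≡ degree M X y
      dot-col y = ∑-cong X (λ x → ind-idem (M x y))

      module Codegrees {y} (y∈Y : y ∈ Y) where
        d : ℚ
        d = degree M X y

        codeg : B → ℚ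
        codeg z = dot X (col z) (col y)

        0≤codeg : ∀ z → 0ℚ ≤ codeg z
        0≤codeg z = ∑-nonneg X (λ {x} _ → 0≤* (0≤ind (M x z)) (0≤ind (M x y)))

        ω*codeg≤1 : ∀ z → ω z * codeg z ≤ 1ℚ
        ω*codeg≤1 z = begin
          ω z * codeg z    ≤⟨ *-monoˡ-≤ (0≤ω z) (≤-trans codeg≤degree (degree≤D z)) ⟩
          ω z * D z        ≤⟨ ≤-by (0≤ω z) (solve 2 (λ w D → w := (con 1ℚ :+ D) :* w :- w :* D)
                                refl (ω z) (D z)) ⟩
          (1ℚ + D z) * ω z ≡⟨ [1+D]ω≡1 z ⟩
          1ℚ               ∎
          where
          open ≤-Reasoning
          codeg≤degree : codeg z ≤ degree M X z
          codeg≤degree = ∑-mono X (λ {x} _ → subst (ind (M x z) * ind (M x y) ≤_) (*-identityʳ _)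
            (*-monoˡ-≤ (0≤ind (M x z)) (ind≤1 (M x y))))

        N : List A
        N = filter (λ x → M x y Bool.≟ true) X

        size-N : size N ≡ d
        size-N = trans (∑-filter (λ x → M x y) X (λ _ → 1ℚ)) (∑-cong X (λ x → *-identityʳ _))

        edges-N : ∀ Z → edges M N Z ≡ ∑ Z codeg
        edges-N Z = trans (∑-swap N Z (λ x z → ind (M x z)))
          (∑-cong Z (λ z → trans (∑-filter (λ x → M x y) X _) (dot-comm X (col y) (col z))))

        high? : Decidable (λ z → 2ℚ * f < codeg z)
        high? z = 2ℚ * f <? codeg z

        high low : List B
        high = filter high? Y
        low = filter (∁? high?) Y

        -- Let E be the number of ones between N and the h high columns. Sparsity gives E ≤ f(d + h)
        -- and the definition of high gives E ≥ 2fh; doubling the first and eliminating h leaves E ≤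
        -- 2fd.
        high-sum : ∑ high codeg ≤ 2ℚ * f * d
        high-sum = ≤-by (0≤+ (0≤diff sparse-N) (0≤+ (0≤diff sparse-N) (0≤diff many)))
          (solve 4 (λ f d h E →
            f :* (d :+ h) :- E :+ (f :* (d :+ h) :- E :+ (E :- h :* (con 2ℚ :* f))) :=
            con 2ℚ :* f :* d :- E) refl f d (size high) (∑ high codeg))
          where
          sparse-N : ∑ high codeg ≤ f * (d + size high)
          sparse-N = subst₂ (λ s n → s ≤ f * (n + size high)) (edges-N high) size-N
            (sparse (filter-⊆ _ X) (filter-⊆ high? Y) y∈Y (Allₚ.all-filter (λ x → M x y Bool.≟ true) X))
          many : size high * (2ℚ * f) ≤ ∑ high codeg
          many = subst (_≤ ∑ high codeg) (∑-const high _)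
            (∑-mono high (λ {z} z∈ → <⇒≤ (proj₂ (∈-filter⁻ high? {xs = Y} z∈))))

        ω-sum : ∑ Y (λ z → ω z * codeg z) ≤ 8ℚ * d
        ω-sum = begin
          ∑ Y (λ z → ω z * codeg z)
            ≡⟨ ∑-cong Y (λ z → sym (∑-*ˡ X (ω z) _)) ⟩
          ∑ Y (λ z → ∑ X (λ x → ω z * (ind (M x z) * ind (M x y))))
            ≡⟨ ∑-swap Y X _ ⟩
          ∑ X (λ x → ∑ Y (λ z → ω z * (ind (M x z) * ind (M x y))))
            ≡⟨ ∑-cong X (λ x → trans (∑-cong Y (λ z → sym (*-assoc (ω z) _ _)))
                 (∑-*ʳ Y (ind (M x y)) _)) ⟩
          ∑ X (λ x → ∑ Y (λ z → ω z * ind (M x z)) * ind (M x y))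
            ≤⟨ ∑-mono X (λ {x} x∈X → *-monoʳ-≤ (0≤ind (M x y)) (load≤8 x∈X)) ⟩
          ∑ X (λ x → 8ℚ * ind (M x y))
            ≡⟨ ∑-*ˡ X 8ℚ _ ⟩
          8ℚ * d ∎
          where open ≤-Reasoning

        0≤ω*codeg : ∀ z → 0ℚ ≤ ω z * codeg z
        0≤ω*codeg z = 0≤* (0≤ω z) (0≤codeg z)

        -- Each term ω codeg² sheds one factor: on `high` because ω codeg ≤ 1, on `low` because
        -- codeg ≤ 2f. The linear sums that remain are those of `high-sum` and `ω-sum`.
        form-bound : form Y (col y) (col y) ≤ κ f * dot X (col y) (col y)
        form-bound = begin
          dot X (col y) (col y) + ∑ Y (λ z → ω z * (codeg z * codeg z))
            ≡⟨ cong₂ _+_ (dot-col y) (∑-split high? Y _) ⟩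
          d + (∑ high (λ z → ω z * (codeg z * codeg z)) + ∑ low (λ z → ω z * (codeg z * codeg z)))
            ≤⟨ +-monoʳ-≤ d (+-mono-≤
                 (∑-mono high (λ {z} _ → high-term z))
                 (∑-mono low (λ {z} z∈ → low-term z (≮⇒≥ (proj₂ (∈-filter⁻ (∁? high?) {xs = Y} z∈)))))) ⟩
          d + (∑ high codeg + ∑ low (λ z → 2ℚ * f * (ω z * codeg z)))
            ≤⟨ +-monoʳ-≤ d (+-mono-≤ high-sum
                 (∑-⊆ (λ z → 0≤* 0≤2f (0≤ω*codeg z)) (filter-⊆ (∁? high?) Y))) ⟩
          d + (2ℚ * f * d + ∑ Y (λ z → 2ℚ * f * (ω z * codeg z)))
            ≡⟨ cong (λ s → d + (2ℚ * f * d + s)) (∑-*ˡ Y (2ℚ * f) _) ⟩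
          d + (2ℚ * f * d + 2ℚ * f * ∑ Y (λ z → ω z * codeg z))
            ≤⟨ +-monoʳ-≤ d (+-monoʳ-≤ (2ℚ * f * d) (*-monoˡ-≤ 0≤2f ω-sum)) ⟩
          d + (2ℚ * f * d + 2ℚ * f * (8ℚ * d))
            ≡⟨ solve 2 (λ f d → d :+ (con 2ℚ :* f :* d :+ con 2ℚ :* f :* (con 8ℚ :* d)) :=
                                (con 1ℚ :+ con 18ℚ :* f) :* d) refl f d ⟩
          κ f * d
            ≡⟨ cong (κ f *_) (dot-col y) ⟨
          κ f * dot X (col y) (col y) ∎
          where
          open ≤-Reasoning
          0≤2f : 0ℚ ≤ 2ℚ * f
          0≤2f = 0≤* (nonNegative⁻¹ 2ℚ) 0≤f
          high-term : ∀ z → ω z * (codeg z * codeg z) ≤ codeg z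
          high-term z = subst₂ _≤_ (*-assoc (ω z) _ _) (*-identityˡ _)
            (*-monoʳ-≤ (0≤codeg z) (ω*codeg≤1 z))
          low-term : ∀ z → codeg z ≤ 2ℚ * f → ω z * (codeg z * codeg z) ≤ 2ℚ * f * (ω z * codeg z)
          low-term z c≤2f = subst₂ _≤_
            (solve 2 (λ w c → w :* c :* c := w :* (c :* c)) refl (ω z) (codeg z))
            (*-comm _ (2ℚ * f)) (*-monoˡ-≤ (0≤ω*codeg z) c≤2f)

    -- In 16e ≤ 16κ²RC|X| + Σ (1 + D y) the last sum takes away at most half of the left side.
    edges-bound : ∑ Y (λ y → 1ℚ + D y) ≤ 8ℚ * edges M X Y →
      edges M X Y ≤ 2ℚ * (κ f * κ f * Γ) * size X
    edges-bound Σθ≤8e = *-cancelˡ-≤ (positive⁻¹ 8ℚ)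
      (≤-by (0≤+ (0≤+ (0≤diff bound) (0≤diff Σθ≤8e))
          (0≤* (0≤* (nonNegative⁻¹ 16ℚ) (0≤* (0≤² (κ f)) (size-nonneg X))) (0≤diff RC≤Γ)))
        (solve 6 (λ k rc g n θ e →
          (con 16ℚ :* k :* rc :* n :+ θ :- con 16ℚ :* e) :+ (con 8ℚ :* e :- θ) :+
            con 16ℚ :* (k :* n) :* (g :- rc) :=
          con 8ℚ :* (con 2ℚ :* (k :* g) :* n) :- con 8ℚ :* e)
          refl (κ f * κ f) (R * C) Γ (size X) (∑ Y (λ y → 1ℚ + D y)) (edges M X Y)))
      where
      0<κ : 0ℚ < κ f
      0<κ = <-≤-trans (positive⁻¹ 1ℚ) (≤-by (0≤* (nonNegative⁻¹ 18ℚ) 0≤f)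
        (solve 1 (λ f → con 18ℚ :* f := con 1ℚ :+ con 18ℚ :* f :- con 1ℚ) refl f))
      bound : 16ℚ * edges M X Y ≤ 16ℚ * (κ f * κ f) * (R * C) * size X + ∑ Y (λ y → 1ℚ + D y)
      bound = subst (λ s → 16ℚ * s ≤ _)
        (trans (∑-cong Y dot-col) (∑-swap Y X _))
        (Factorization.degree-sum-bound coordinates (λ x y → ind (M x y)) u v uv≡M R C 0<C ∣u∣²≤R ∣v∣²≤C
          X Y ω (λ y → 1ℚ + D y) 0≤ω (λ y → 0≤+ (nonNegative⁻¹ 1ℚ) (0≤D y)) [1+D]ω≡1 (κ f) 0<κ
          (λ y∈Y → Codegrees.form-bound y∈Y))

  -- Loads of rows, and the separation of heavy from light rows

  module Loads (M : A → B → Bool) (X : List A) (Y : List B) where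

    private
      inverse : ∀ y → ∃[ w ] 0ℚ < w × (1ℚ + degree M X y) * w ≡ 1ℚ
      inverse y = reciprocal {1ℚ + degree M X y} (<-≤-trans (positive⁻¹ 1ℚ)
        (≤-by (degree-nonneg M X y) (solve 1 (λ d → d := con 1ℚ :+ d :- con 1ℚ) refl (degree M X y))))

    ω : B → ℚ
    ω y = proj₁ (inverse y)

    0≤ω : ∀ y → 0ℚ ≤ ω y
    0≤ω y = <⇒≤ (proj₁ (proj₂ (inverse y)))

    [1+D]ω≡1 : ∀ y → (1ℚ + degree M X y) * ω y ≡ 1ℚ
    [1+D]ω≡1 y = proj₂ (proj₂ (inverse y))

    load : A → ℚ
    load x = ∑ Y (λ y → ω y * ind (M x y))

    heavy? : Decidable (λ x → 8ℚ < load x)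
    heavy? x = 8ℚ <? load x

    heavy light : List A
    heavy = filter heavy? X
    light = filter (∁? heavy?) X

    light-load : ∀ {x} → x ∈ light → load x ≤ 8ℚ
    light-load x∈ = ≮⇒≥ (proj₂ (∈-filter⁻ (∁? heavy?) {xs = X} x∈))

    -- Markov's inequality: the loads of all rows sum to Σ_y d_y / (1 + d_y), which is at most |Y|.
    heavy-few : size heavy * 8ℚ ≤ size Y
    heavy-few = begin
      size heavy * 8ℚ
        ≡⟨ ∑-const heavy 8ℚ ⟨
      ∑ heavy (λ _ → 8ℚ)
        ≤⟨ ∑-mono heavy (λ x∈ → <⇒≤ (proj₂ (∈-filter⁻ heavy? {xs = X} x∈))) ⟩
      ∑ heavy load
        ≤⟨ ∑-⊆ (λ x → ∑-nonneg Y (λ {y} _ → 0≤* (0≤ω y) (0≤ind (M x y)))) (filter-⊆ heavy? X) ⟩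
      ∑ X load
        ≡⟨ trans (∑-swap X Y _) (∑-cong Y (λ y → ∑-*ˡ X (ω y) (λ x → ind (M x y)))) ⟩
      ∑ Y (λ y → ω y * degree M X y)
        ≤⟨ ∑-mono Y (λ {y} _ → ≤-by (0≤ω y)
             (trans (solve 2 (λ w D → w := (con 1ℚ :+ D) :* w :- w :* D) refl (ω y) (degree M X y))
               (cong (_- ω y * degree M X y) ([1+D]ω≡1 y)))) ⟩
      size Y ∎
      where open ≤-Reasoning

    light-edges-bound : ∀ {Γ f} → BoundedFactorization M Γ → 0ℚ ≤ f → LocallySparse M f X Y →
      size Y + edges M X Y ≤ 8ℚ * edges M light Y →
      edges M light Y ≤ 2ℚ * (κ f * κ f * Γ) * size light
    light-edges-bound {f = f} φ 0≤f sparse Σθ≤8e =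
      edges-bound φ 0≤f light Y (degree M X) ω (degree-nonneg M X) 0≤ω [1+D]ω≡1
        (λ y → ∑-⊆ (λ x → 0≤ind (M x y)) (filter-⊆ (∁? heavy?) X))
        light-load (locallySparse-⊆ M f (filter-⊆ (∁? heavy?) X) ⊆-refl sparse)
        (subst (_≤ 8ℚ * edges M light Y)
          (sym (trans (∑-+ Y (λ _ → 1ℚ) (degree M X)) (cong (size Y +_) (sym (∑-swap X Y _)))))
          Σθ≤8e)

  -- The bound n + ½ on the size of a pair. A size of at most ½ means empty, and (1 + h)/4 ≤ h for h
  -- ≥ ½, so a fourfold decrease lowers n by one with no appeal to integrality of sizes.
  ½+_ : ℕ → ℚ
  ½+ zero  = ½
  ½+ suc n = 1ℚ + ½+ n

  ½≤½+ : ∀ n → ½ ≤ ½+ n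
  ½≤½+ zero    = ≤-refl
  ½≤½+ (suc n) = ≤-trans (½≤½+ n) (≤-by (nonNegative⁻¹ 1ℚ)
    (solve 1 (λ h → con 1ℚ := con 1ℚ :+ h :- h) refl (½+ n)))

  size≤½⇒empty : (X : List A) → size X ≤ ½ → X ≡ []
  size≤½⇒empty []      _  = refl
  size≤½⇒empty (x ∷ X) ≤½ = contradiction
    (≤-trans (≤-by (size-nonneg X) (solve 1 (λ s → s := con 1ℚ :+ s :- con 1ℚ) refl (size X))) ≤½)
    (toWitnessFalse {a? = 1ℚ ≤? ½} _)

  size≤½+length : (X : List A) → size X ≤ ½+ (length X)
  size≤½+length []      = nonNegative⁻¹ ½
  size≤½+length (x ∷ X) = +-monoʳ-≤ 1ℚ (size≤½+length X)

  -- The 8 is 4 · 2 from the heavy case, where e ≤ 4e₃ and e₃ ≤ 2κ²Γ|Y|. The summand 1 ensures that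
  -- a pair violating the bound has |Y| ≤ e.
  8κ²Γ+1 : ℚ → ℚ → ℚ
  8κ²Γ+1 Γ f = 8ℚ * (κ f * κ f * Γ) + 1ℚ

  private
    y≤Fs : ∀ g x y → 0ℚ ≤ g → 0ℚ ≤ x → 0ℚ ≤ y → y ≤ (8ℚ * g + 1ℚ) * (x + y)
    y≤Fs g x y 0≤g 0≤x 0≤y =
      ≤-by (0≤+ 0≤x (0≤* (0≤* (nonNegative⁻¹ 8ℚ) 0≤g) (0≤+ 0≤x 0≤y)))
        (solve 3 (λ g x y → x :+ con 8ℚ :* g :* (x :+ y) :=
                   (con 8ℚ :* g :+ con 1ℚ) :* (x :+ y) :- y) refl g x y)

    light-degrees : ∀ e e₁ y → y ≤ e → e ≤ 2ℚ * e₁ → 0ℚ ≤ e₁ → y + e ≤ 8ℚ * e₁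
    light-degrees e e₁ y y≤e e≤2e₁ 0≤e₁ =
      ≤-by (0≤+ (0≤+ (0≤diff y≤e) (0≤* (nonNegative⁻¹ 2ℚ) (0≤diff e≤2e₁)))
          (0≤* (nonNegative⁻¹ 4ℚ) 0≤e₁))
        (solve 3 (λ y e e₁ → (e :- y) :+ con 2ℚ :* (con 2ℚ :* e₁ :- e) :+ con 4ℚ :* e₁ :=
                             con 8ℚ :* e₁ :- (y :+ e)) refl y e e₁)

    light-conclusion : ∀ e e₁ g x x₁ y → 0ℚ ≤ g → 0ℚ ≤ x → 0ℚ ≤ y → x₁ ≤ x →
      e ≤ 2ℚ * e₁ → e₁ ≤ 2ℚ * g * x₁ → e ≤ (8ℚ * g + 1ℚ) * (x + y)
    light-conclusion e e₁ g x x₁ y 0≤g 0≤x 0≤y x₁≤x e≤2e₁ bound =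
      ≤-by (0≤+ (0≤+ (0≤diff e≤2e₁) (0≤* (nonNegative⁻¹ 2ℚ) (0≤diff bound)))
          (0≤+ (0≤+ (0≤* (0≤* (nonNegative⁻¹ 4ℚ) 0≤g) (0≤+ 0≤x (0≤diff x₁≤x)))
            (0≤* (0≤* (nonNegative⁻¹ 8ℚ) 0≤g) 0≤y)) (0≤+ 0≤x 0≤y)))
        (solve 6 (λ e e₁ g x x₁ y →
          (con 2ℚ :* e₁ :- e) :+ con 2ℚ :* (con 2ℚ :* g :* x₁ :- e₁) :+
          (con 4ℚ :* g :* (x :+ (x :- x₁)) :+ con 8ℚ :* g :* y :+ (x :+ y)) :=
          (con 8ℚ :* g :+ con 1ℚ) :* (x :+ y) :- e) refl e e₁ g x x₁ y)

    quarter : ∀ x₂ y₂ y → 0ℚ ≤ x₂ → x₂ * 8ℚ ≤ y → y₂ * 8ℚ ≤ x₂ → 4ℚ * (x₂ + y₂) ≤ y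
    quarter x₂ y₂ y 0≤x₂ 8x₂≤y 8y₂≤x₂ =
      ≤-by (0≤+ (0≤diff 8x₂≤y) (0≤+ (0≤* (nonNegative⁻¹ ½) (0≤diff 8y₂≤x₂))
          (0≤+ (0≤* (nonNegative⁻¹ 2ℚ) 0≤x₂) (0≤+ 0≤x₂ (0≤* (nonNegative⁻¹ ½) 0≤x₂)))))
        (solve 3 (λ x₂ y₂ y → (y :- x₂ :* con 8ℚ) :+ (con ½ :* (x₂ :- y₂ :* con 8ℚ) :+
          (con 2ℚ :* x₂ :+ (x₂ :+ con ½ :* x₂))) := y :- con 4ℚ :* (x₂ :+ y₂)) refl x₂ y₂ y)

    smaller : ∀ h x y z → 0ℚ ≤ x → ½ ≤ h → 4ℚ * z ≤ y → x + y ≤ 1ℚ + h → z ≤ h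
    smaller h x y z 0≤x ½≤h 4z≤y x+y≤1+h =
      *-cancelˡ-≤ (positive⁻¹ 4ℚ) (≤-by
        (0≤+ (0≤+ (0≤diff 4z≤y) 0≤x) (0≤+ (0≤diff x+y≤1+h)
          (0≤+ (0≤+ (0≤diff ½≤h) (0≤* (nonNegative⁻¹ 2ℚ) (0≤diff ½≤h))) (nonNegative⁻¹ ½))))
        (solve 4 (λ h x y z → (y :- con 4ℚ :* z) :+ x :+ ((con 1ℚ :+ h :- (x :+ y)) :+
            ((h :- con ½) :+ con 2ℚ :* (h :- con ½) :+ con ½)) := con 4ℚ :* h :- con 4ℚ :* z)
          refl h x y z))

    -- The heavy rows carry at least e/2, and the recursive part takes at most Fz ≤ Fy/4 ≤ e/4 of
    -- it; hence e₃ ≥ e/4.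
    core-edges : ∀ e e₁ e₂ e₃ e₄ F x y z → 0ℚ ≤ F → 0ℚ ≤ x → e ≡ e₂ + e₁ → e₂ ≡ e₄ + e₃ →
      2ℚ * e₁ ≤ e → F * (x + y) ≤ e → 4ℚ * z ≤ y → e₄ ≤ F * z → e ≤ 4ℚ * e₃
    core-edges _ e₁ _ e₃ e₄ F x y z 0≤F 0≤x refl refl 2e₁≤e Fs≤e 4z≤y e₄≤Fz =
      ≤-by (0≤+ (0≤+ (0≤* (nonNegative⁻¹ 2ℚ) (0≤diff 2e₁≤e)) (0≤diff Fs≤e))
          (0≤+ (0≤* (nonNegative⁻¹ 4ℚ) (0≤diff e₄≤Fz)) (0≤* 0≤F (0≤+ 0≤x (0≤diff 4z≤y)))))
        (solve 7 (λ e₁ e₃ e₄ F x y z →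
          con 2ℚ :* ((e₄ :+ e₃ :+ e₁) :- con 2ℚ :* e₁) :+ ((e₄ :+ e₃ :+ e₁) :- F :* (x :+ y)) :+
          (con 4ℚ :* (F :* z :- e₄) :+ F :* (x :+ (y :- con 4ℚ :* z))) :=
          con 4ℚ :* e₃ :- (e₄ :+ e₃ :+ e₁)) refl e₁ e₃ e₄ F x y z)

    heavy-degrees : ∀ e e₂ e₃ x₂ y₂ y → 0ℚ ≤ x₂ → 0ℚ ≤ y₂ → 4ℚ * (x₂ + y₂) ≤ y → y ≤ e →
      e₂ ≤ e → e ≤ 4ℚ * e₃ → x₂ + e₂ ≤ 8ℚ * e₃
    heavy-degrees e e₂ e₃ x₂ y₂ y 0≤x₂ 0≤y₂ few y≤e e₂≤e e≤4e₃ =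
      ≤-by (0≤+ (0≤+ (0≤* (nonNegative⁻¹ 2ℚ) (0≤diff e≤4e₃)) (0≤diff y≤e))
          (0≤+ (0≤+ (0≤diff few) (0≤+ (0≤+ 0≤x₂ (0≤* (nonNegative⁻¹ 2ℚ) 0≤x₂))
            (0≤* (nonNegative⁻¹ 4ℚ) 0≤y₂))) (0≤diff e₂≤e)))
        (solve 6 (λ e e₂ e₃ x₂ y₂ y →
          con 2ℚ :* (con 4ℚ :* e₃ :- e) :+ (e :- y) :+ ((y :- con 4ℚ :* (x₂ :+ y₂)) :+
            (x₂ :+ con 2ℚ :* x₂ :+ con 4ℚ :* y₂) :+ (e :- e₂)) :=
          con 8ℚ :* e₃ :- (x₂ :+ e₂)) refl e e₂ e₃ x₂ y₂ y)

    heavy-conclusion : ∀ e e₃ g x y y₁ → 0ℚ ≤ g → 0ℚ ≤ x → 0ℚ ≤ y → y₁ ≤ y →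
      e ≤ 4ℚ * e₃ → e₃ ≤ 2ℚ * g * y₁ → e ≤ (8ℚ * g + 1ℚ) * (x + y)
    heavy-conclusion e e₃ g x y y₁ 0≤g 0≤x 0≤y y₁≤y e≤4e₃ bound =
      ≤-by (0≤+ (0≤+ (0≤diff e≤4e₃) (0≤* (nonNegative⁻¹ 4ℚ) (0≤diff bound)))
          (0≤+ (0≤* (0≤* (nonNegative⁻¹ 8ℚ) 0≤g) (0≤+ 0≤x (0≤diff y₁≤y))) (0≤+ 0≤x 0≤y)))
        (solve 6 (λ e e₃ g x y y₁ →
          (con 4ℚ :* e₃ :- e) :+ con 4ℚ :* (con 2ℚ :* g :* y₁ :- e₃) :+
          (con 8ℚ :* g :* (x :+ (y :- y₁)) :+ (x :+ y)) :=
          (con 8ℚ :* g :+ con 1ℚ) :* (x :+ y) :- e) refl e e₃ g x y y₁)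

  module _ {A B : Set} {M : A → B → Bool} {Γ f : ℚ} (φ : BoundedFactorization M Γ) (0≤f : 0ℚ ≤ f) where

    private
      F k : ℚ
      F = 8κ²Γ+1 Γ f
      k = κ f * κ f

      0≤Γ : 0ℚ ≤ Γ
      0≤Γ = ≤-trans (<⇒≤ (0<* 0<R 0<C)) RC≤Γ
        where open BoundedFactorization φ

      0≤kΓ : 0ℚ ≤ k * Γ
      0≤kΓ = 0≤* (0≤² (κ f)) 0≤Γ

      0≤F : 0ℚ ≤ F
      0≤F = 0≤+ (0≤* (nonNegative⁻¹ 8ℚ) 0≤kΓ) (nonNegative⁻¹ 1ℚ)

      -- The size of the pair decreases by at least a factor 4 in the recursive call.
      bounded-by-fuel : ∀ n X Y → size X + size Y ≤ ½+ n →
        LocallySparse M f X Y → LocallySparse (flip M) f Y X →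
        edges M X Y ≤ F * (size X + size Y)
      bounded-by-fuel zero X Y s≤½ _ _ = begin
        edges M X Y          ≡⟨ cong (λ X → edges M X Y) (size≤½⇒empty X (≤-trans
                                  (≤-by (size-nonneg Y) (solve 2 (λ x y → y := x :+ y :- x)
                                    refl (size X) (size Y))) s≤½)) ⟩
        0ℚ                   ≤⟨ 0≤* 0≤F (0≤+ (size-nonneg X) (size-nonneg Y)) ⟩
        F * (size X + size Y) ∎
        where open ≤-Reasoning
      -- The bound is decided first: its failure supplies |Y| ≤ e, so that the total weight |Y| + e
      -- is a multiple of e up to a constant.
      bounded-by-fuel (suc n) X Y s≤ sparse sparseᵀ = step (edges M X Y ≤? F * s)
        where
        s e : ℚ
        s = size X + size Y
        e = edges M X Y
        module L = Loads M X Y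
        e₁ e₂ : ℚ
        e₁ = edges M L.light Y
        e₂ = edges M L.heavy Y
        e≡e₂+e₁ : e ≡ e₂ + e₁
        e≡e₂+e₁ = ∑-split L.heavy? X _
        -- Exchanged roles: the columns now bear the loads, and the few heavy rows define the
        -- weights. Only heavy rows against heavy columns are left for the recursive call.
        module L′ = Loads (flip M) Y L.heavy
        e₃ e₄ : ℚ
        e₃ = edges M L.heavy L′.light
        e₄ = edges M L.heavy L′.heavy
        e₂≡e₄+e₃ : e₂ ≡ e₄ + e₃
        e₂≡e₄+e₃ = edges-splitʳ M L′.heavy? L.heavy Y

        0≤x 0≤y : _
        0≤x = size-nonneg X
        0≤y = size-nonneg Y

        y≤e : F * s < e → size Y ≤ e
        y≤e Fs<e = ≤-trans (y≤Fs (k * Γ) (size X) (size Y) 0≤kΓ 0≤x 0≤y) (<⇒≤ Fs<e)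

        light-case : F * s < e → e ≤ 2ℚ * e₁ → e ≤ F * s
        light-case Fs<e e≤2e₁ = light-conclusion e e₁ (k * Γ) (size X) (size L.light) (size Y)
          0≤kΓ 0≤x 0≤y (size-⊆ (filter-⊆ (∁? L.heavy?) X)) e≤2e₁
          (L.light-edges-bound φ 0≤f sparse
            (light-degrees e e₁ (size Y) (y≤e Fs<e) e≤2e₁ (edges-nonneg M L.light Y)))

        heavy-case : F * s < e → 2ℚ * e₁ < e → e ≤ F * s
        heavy-case Fs<e 2e₁<e = heavy-conclusion e e₃ (k * Γ) (size X) (size Y) (size L′.light)
          0≤kΓ 0≤x 0≤y (size-⊆ (filter-⊆ (∁? L′.heavy?) Y)) e≤4e₃
          (subst (_≤ 2ℚ * (k * Γ) * size L′.light) (edges-flip (flip M) L′.light L.heavy)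
            (L′.light-edges-bound (transpose φ) 0≤f
              (locallySparse-⊆ (flip M) f ⊆-refl (filter-⊆ L.heavy? X) sparseᵀ)
              (subst₂ (λ s t → x₂ + s ≤ 8ℚ * t)
                (edges-flip M L.heavy Y) (edges-flip M L.heavy L′.light)
                (heavy-degrees e e₂ e₃ x₂ y₂ (size Y) (size-nonneg L.heavy) (size-nonneg L′.heavy)
                  few (y≤e Fs<e) (edges-⊆ˡ M Y (filter-⊆ L.heavy? X)) e≤4e₃))))
          where
          x₂ y₂ : ℚ
          x₂ = size L.heavy
          y₂ = size L′.heavy
          few : 4ℚ * (x₂ + y₂) ≤ size Y
          few = quarter x₂ y₂ (size Y) (size-nonneg L.heavy) L.heavy-few L′.heavy-few
          e₄≤ : e₄ ≤ F * (x₂ + y₂)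
          e₄≤ = bounded-by-fuel n L.heavy L′.heavy
            (smaller (½+ n) (size X) (size Y) (x₂ + y₂) 0≤x (½≤½+ n) few s≤)
            (locallySparse-⊆ M f (filter-⊆ L.heavy? X) (filter-⊆ L′.heavy? Y) sparse)
            (locallySparse-⊆ (flip M) f (filter-⊆ L′.heavy? Y) (filter-⊆ L.heavy? X) sparseᵀ)
          e≤4e₃ : e ≤ 4ℚ * e₃
          e≤4e₃ = core-edges e e₁ e₂ e₃ e₄ F (size X) (size Y) (x₂ + y₂) 0≤F 0≤x
            e≡e₂+e₁ e₂≡e₄+e₃ (<⇒≤ 2e₁<e) (<⇒≤ Fs<e) few e₄≤

        step : Dec (e ≤ F * s) → e ≤ F * s
        step (yes e≤Fs) = e≤Fs
        step (no e≰Fs)  = cases (e ≤? 2ℚ * e₁)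
          where
          cases : Dec (e ≤ 2ℚ * e₁) → e ≤ F * s
          cases (yes e≤2e₁) = light-case (≰⇒> e≰Fs) e≤2e₁
          cases (no e≰2e₁)  = heavy-case (≰⇒> e≰Fs) (≰⇒> e≰2e₁)

    locallySparse⇒edges-bound : ∀ {X Y} →
      LocallySparse M f X Y → LocallySparse (flip M) f Y X →
      edges M X Y ≤ F * (size X + size Y)
    locallySparse⇒edges-bound {X} {Y} = bounded-by-fuel (length X ℕ.+ length Y) X Y
      (sizes≤ X Y)
      where
      sizes≤ : ∀ (X : List A) (Y : List B) → size X + size Y ≤ ½+ (length X ℕ.+ length Y)
      sizes≤ []      Y = subst (_≤ ½+ (length Y)) (sym (+-identityˡ (size Y))) (size≤½+length Y)
      sizes≤ (x ∷ X) Y = subst (_≤ 1ℚ + ½+ (length X ℕ.+ length Y))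
        (sym (+-assoc 1ℚ (size X) (size Y))) (+-monoʳ-≤ 1ℚ (sizes≤ X Y))

  -- Descent on the radius of balls containing the row and column vectors

  ι : ℕ → ℚ
  ι zero    = 0ℚ
  ι (suc n) = 1ℚ + ι n

  ι-nonneg : ∀ n → 0ℚ ≤ ι n
  ι-nonneg zero    = ≤-refl
  ι-nonneg (suc n) = 0≤+ (nonNegative⁻¹ 1ℚ) (ι-nonneg n)

  ι-mono-≤ : ∀ {m n} → m ℕ.≤ n → ι m ≤ ι n
  ι-mono-≤ {n = n} ℕ.z≤n = ι-nonneg n
  ι-mono-≤ (ℕ.s≤s m≤n)   = +-monoʳ-≤ 1ℚ (ι-mono-≤ m≤n)

  size≡ι : (X : List A) → size X ≡ ι (length X)
  size≡ι []      = refl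
  size≡ι (x ∷ X) = cong (1ℚ +_) (size≡ι X)

  unique-⊆ : {X′ X : List A} → X′ ⊆ X → Unique X → Unique X′
  unique-⊆ []           []        = []
  unique-⊆ (x ∷ʳ τ)     (_ ∷ !X)  = unique-⊆ τ !X
  unique-⊆ (refl ∷ τ)   (x∉ ∷ !X) = All-resp-⊆ τ x∉ ∷ unique-⊆ τ !X

  edges≤size*size : ∀ (M : A → B → Bool) X Y → edges M X Y ≤ size X * size Y
  edges≤size*size M X Y = subst (edges M X Y ≤_) (∑-const X (size Y))
    (∑-mono X (λ {x} _ → ∑-mono Y (λ {y} _ → ind≤1 (M x y))))

  NoBiclique : ℕ → (A → B → Bool) → Set
  NoBiclique t M = ∀ {X Y} → Unique X → Unique Y → length X ≡ t → length Y ≡ t →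
    ¬ (∀ {x y} → x ∈ X → y ∈ Y → M x y ≡ true)

  noBiclique-flip : ∀ {t} {M : A → B → Bool} → NoBiclique t M → NoBiclique t (flip M)
  noBiclique-flip free !Y !X ∣Y∣≡t ∣X∣≡t all-ones =
    free !X !Y ∣X∣≡t ∣Y∣≡t (λ x∈X y∈Y → all-ones y∈Y x∈X)

  -- All but fewer than t rows lie outside the neighbourhood of one of t given columns.
  module Exceptional {M : A → B → Bool} {t : ℕ} (free : NoBiclique t M)
    {f : ℚ} (0≤f : 0ℚ ≤ f) (Y : List B) (!Y : Unique Y) where

    private
      common : List A → List B → List A
      common X []       = X
      common X (z ∷ zs) = common (filter (λ x → M x z Bool.≟ true) X) zs

      common-⊆ : ∀ X zs → common X zs ⊆ X
      common-⊆ X []       = ⊆-refl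
      common-⊆ X (z ∷ zs) = ⊆-trans (common-⊆ _ zs) (filter-⊆ (λ x → M x z Bool.≟ true) X)

      common-adjacent : ∀ X zs {x z} → x ∈ common X zs → z ∈ zs → M x z ≡ true
      common-adjacent X (z ∷ zs) x∈ (here refl) =
        proj₂ (∈-filter⁻ (λ x → M x z Bool.≟ true) {xs = X} (lookup (common-⊆ _ zs) x∈))
      common-adjacent X (z ∷ zs) x∈ (there z∈)  = common-adjacent _ zs x∈ z∈

      Sparse : List A → Set
      Sparse X = ∀ {X′ z} → X′ ⊆ X → z ∈ Y → All (λ x → M x z ≡ false) X′ →
        edges M X′ Y ≤ f * (size X′ + size Y)

      -- Every z splits off its non-neighbours, a sparse set costing one multiple of f(|X| + |Y|);
      -- the rows that survive are adjacent to all of `zs`.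
      peel : ∀ X zs → Sparse X → All (_∈ Y) zs →
        edges M X Y ≤ ι (length zs) * (f * (size X + size Y)) + edges M (common X zs) Y
      peel X []       _      _          =
        ≤-reflexive (solve 2 (λ s e → e := con 0ℚ :* s :+ e) refl (f * (size X + size Y)) (edges M X Y))
      peel X (z ∷ zs) sparse (z∈ ∷ zs∈) = begin
        edges M X Y
          ≡⟨ ∑-split adj? X _ ⟩
        edges M N Y + edges M (filter (∁? adj?) X) Y
          ≤⟨ +-mono-≤ (peel N zs (λ X′⊆N → sparse (⊆-trans X′⊆N (filter-⊆ adj? X))) zs∈)
               (sparse (filter-⊆ (∁? adj?) X) z∈
                 (All.map Bool.¬-not (Allₚ.all-filter (∁? adj?) X))) ⟩
        ι (length zs) * (f * (size N + size Y)) + E + f * (size (filter (∁? adj?) X) + size Y)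
          ≤⟨ +-mono-≤ (+-monoˡ-≤ E (*-monoˡ-≤ (ι-nonneg (length zs)) (step (filter-⊆ adj? X))))
               (step (filter-⊆ (∁? adj?) X)) ⟩
        ι (length zs) * s + E + s
          ≡⟨ solve 3 (λ k s e → k :* s :+ e :+ s := (con 1ℚ :+ k) :* s :+ e) refl (ι (length zs)) s E ⟩
        (1ℚ + ι (length zs)) * s + E ∎
        where
        open ≤-Reasoning
        adj? : Decidable (λ x → M x z ≡ true)
        adj? x = M x z Bool.≟ true
        N : List A
        N = filter adj? X
        s E : ℚ
        s = f * (size X + size Y)
        E = edges M (common N zs) Y
        step : ∀ {X′} → X′ ⊆ X → f * (size X′ + size Y) ≤ s
        step X′⊆X = *-monoˡ-≤ 0≤f (+-monoˡ-≤ (size Y) (size-⊆ X′⊆X))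

    -- For t columns of Y, more than t common neighbours would contain a forbidden biclique, so
    -- these rows contribute at most t|Y| beyond the peeled ones. If Y has fewer than t columns, the
    -- total is at most t|X|.
    exceptional-bound : ∀ X → Unique X → Sparse X →
      edges M X Y ≤ ι t * (f + 1ℚ) * (size X + size Y)
    exceptional-bound X !X sparse = cases (t ℕₚ.≤? length Y)
      where
      open ≤-Reasoning
      T x y : ℚ
      T = ι t
      x = size X
      y = size Y
      0≤T : 0ℚ ≤ T
      0≤T = ι-nonneg t
      0≤x : 0ℚ ≤ x
      0≤x = size-nonneg X
      0≤y : 0ℚ ≤ y
      0≤y = size-nonneg Y

      cases : Dec (t ℕ.≤ length Y) → edges M X Y ≤ T * (f + 1ℚ) * (x + y)
      cases (no t≰∣Y∣) = begin
        edges M X Y  ≤⟨ edges≤size*size M X Y ⟩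
        x * y        ≤⟨ *-monoˡ-≤ 0≤x (subst (_≤ T) (sym (size≡ι Y)) (ι-mono-≤ (ℕₚ.<⇒≤ (ℕₚ.≰⇒> t≰∣Y∣)))) ⟩
        x * T        ≤⟨ ≤-by (0≤* 0≤T (0≤+ (0≤* 0≤f (0≤+ 0≤x 0≤y)) 0≤y))
                          (solve 4 (λ T f x y → T :* (f :* (x :+ y) :+ y) :=
                            T :* (f :+ con 1ℚ) :* (x :+ y) :- x :* T) refl T f x y) ⟩
        T * (f + 1ℚ) * (x + y) ∎
      cases (yes t≤∣Y∣) = begin
        edges M X Y
          ≤⟨ peel X zs sparse (Allₚ.take⁺ t (All.tabulate id)) ⟩
        ι (length zs) * (f * (x + y)) + edges M (common X zs) Y
          ≡⟨ cong (λ k → ι k * (f * (x + y)) + edges M (common X zs) Y) ∣zs∣≡t ⟩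
        T * (f * (x + y)) + edges M (common X zs) Y
          ≤⟨ +-monoʳ-≤ (T * (f * (x + y))) (≤-trans (edges≤size*size M (common X zs) Y)
               (*-monoʳ-≤ 0≤y (subst (_≤ T) (sym (size≡ι (common X zs))) (ι-mono-≤ few-common)))) ⟩
        T * (f * (x + y)) + T * y
          ≤⟨ ≤-by (0≤* 0≤T 0≤x) (solve 4 (λ T f x y → T :* x :=
               T :* (f :+ con 1ℚ) :* (x :+ y) :- (T :* (f :* (x :+ y)) :+ T :* y)) refl T f x y) ⟩
        T * (f + 1ℚ) * (x + y) ∎
        where
        zs : List B
        zs = take t Y
        ∣zs∣≡t : length zs ≡ t
        ∣zs∣≡t = trans (length-take t Y) (ℕₚ.m≤n⇒m⊓n≡m t≤∣Y∣)
        few-common : length (common X zs) ℕ.≤ t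
        few-common = ℕₚ.≮⇒≥ λ t<∣C∣ →
          free (Uniqueₚ.take⁺ t (unique-⊆ (common-⊆ X zs) !X)) (Uniqueₚ.take⁺ t !Y)
            (trans (length-take t (common X zs)) (ℕₚ.m≤n⇒m⊓n≡m (ℕₚ.<⇒≤ t<∣C∣))) ∣zs∣≡t
            (λ x∈ z∈ → common-adjacent X zs
              (All.lookup (Allₚ.take⁺ t (All.tabulate id)) x∈) z∈)

  module Balls {M : A → B → Bool} {Γ : ℚ} (φ : BoundedFactorization M Γ) where
    open BoundedFactorization φ

    ⟨_,_⟩ : (Coordinate → ℚ) → (Coordinate → ℚ) → ℚ
    ⟨ a , b ⟩ = dot coordinates a b

    -- This is 2C(u x - z) with ζ = 2Cz. In this scale the threshold ⟨z , v y⟩ = ½ reads ⟨ζ , v y⟩ =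
    -- C, and the centre moves by exactly ± `v y`.
    offset : (Coordinate → ℚ) → A → Coordinate → ℚ
    offset ζ x l = 2ℚ * C * u x l - ζ l

    -- The row vector u x lies in the ball with centre ζ/2C and squared radius (i − 1)/4C.
    InBall : ℕ → (Coordinate → ℚ) → A → Set
    InBall i ζ x = ⟨ offset ζ x , offset ζ x ⟩ + C ≤ C * ι i

    -- Index 0 stands for a negative squared radius, which makes the base cases of the descent
    -- empty.
    ¬inBall₀ : ∀ {ζ x} → ¬ InBall 0 ζ x
    ¬inBall₀ {ζ} {x} in₀ = <-irrefl refl (begin-strict
      0ℚ                                  <⟨ 0<C ⟩
      C                                   ≤⟨ ≤-by (∑-nonneg coordinates (λ {l} _ → 0≤² (offset ζ x l)))
                                               (solve 2 (λ s C → s := s :+ C :- C) refl ⟨ offset ζ x , offset ζ x ⟩ C) ⟩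
      ⟨ offset ζ x , offset ζ x ⟩ + C     ≤⟨ in₀ ⟩
      C * 0ℚ                              ≡⟨ *-zeroʳ C ⟩
      0ℚ                                  ∎)
      where open ≤-Reasoning

    shift : (Coordinate → ℚ) → ℚ → B → Coordinate → ℚ
    shift ζ s y l = ζ l + s * v y l

    shift-norm : ∀ ζ s x y → ⟨ offset (shift ζ s y) x , offset (shift ζ s y) x ⟩ ≡
      ⟨ offset ζ x , offset ζ x ⟩ +
        (- (2ℚ * s) * (2ℚ * C * ind (M x y) - ⟨ ζ , v y ⟩) + s * s * ⟨ v y , v y ⟩)
    shift-norm ζ s x y = begin
      ⟨ offset (shift ζ s y) x , offset (shift ζ s y) x ⟩
        ≡⟨ ∑-cong coordinates (λ l → solve 5 (λ C u z s v →
             (con 2ℚ :* C :* u :- (z :+ s :* v)) :* (con 2ℚ :* C :* u :- (z :+ s :* v)) :=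
             (con 2ℚ :* C :* u :- z) :* (con 2ℚ :* C :* u :- z) :+
               ((:- (con 2ℚ :* s)) :* (con 2ℚ :* C :* (u :* v) :- z :* v) :+ s :* s :* (v :* v)))
             refl C (u x l) (ζ l) s (v y l)) ⟩
      ∑ coordinates (λ l → offset ζ x l * offset ζ x l +
          (- (2ℚ * s) * (2ℚ * C * (u x l * v y l) - ζ l * v y l) + s * s * (v y l * v y l)))
        ≡⟨ trans (∑-+ coordinates _ _) (cong (⟨ offset ζ x , offset ζ x ⟩ +_)
             (trans (∑-+ coordinates _ _) (cong₂ _+_
               (trans (∑-*ˡ coordinates (- (2ℚ * s)) _) (cong (- (2ℚ * s) *_)
                 (trans (∑-- coordinates _ _) (cong (_- ⟨ ζ , v y ⟩)
                   (trans (∑-*ˡ coordinates (2ℚ * C) _) (cong (2ℚ * C *_) (uv≡M x y)))))))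
               (∑-*ˡ coordinates (s * s) _)))) ⟩
      ⟨ offset ζ x , offset ζ x ⟩ +
        (- (2ℚ * s) * (2ℚ * C * ind (M x y) - ⟨ ζ , v y ⟩) + s * s * ⟨ v y , v y ⟩) ∎
      where open ≡-Reasoning

    -- The squared length changes by -2(2C - ⟨ζ , v y⟩) + |v y|² ≤ -2C + C = -C, which is one unit
    -- of the index.
    inBall-neighbour : ∀ {i ζ x y} → InBall (suc i) ζ x → ⟨ ζ , v y ⟩ ≤ C →
      M x y ≡ true → InBall i (shift ζ 1ℚ y) x
    inBall-neighbour {i} {ζ} {x} {y} in-ball ζv≤C Mxy =
      subst (λ s → s + C ≤ C * ι i)
        (sym (trans (shift-norm ζ 1ℚ x y)
          (cong (λ m → S + (- (2ℚ * 1ℚ) * (2ℚ * C * ind m - ⟨ ζ , v y ⟩) + 1ℚ * 1ℚ * ⟨ v y , v y ⟩)) Mxy)))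
        (≤-by (0≤+ (0≤diff in-ball) (0≤+ (0≤* (nonNegative⁻¹ 2ℚ) (0≤diff ζv≤C)) (0≤diff (∣v∣²≤C y))))
          (solve 5 (λ C i S z w →
            C :* (con 1ℚ :+ i) :- (S :+ C) :+ (con 2ℚ :* (C :- z) :+ (C :- w)) :=
            C :* i :- (S :+ ((:- (con 2ℚ :* con 1ℚ)) :* (con 2ℚ :* C :* con 1ℚ :- z) :+
              con 1ℚ :* con 1ℚ :* w) :+ C)) refl C (ι i) S ⟨ ζ , v y ⟩ ⟨ v y , v y ⟩))
      where
      S : ℚ
      S = ⟨ offset ζ x , offset ζ x ⟩

    -- Moving the other way, the change is -2⟨ζ , v y⟩ + |v y|² ≤ -C, the entry of M being 0.
    inBall-nonNeighbour : ∀ {i ζ x y} → InBall (suc i) ζ x → C ≤ ⟨ ζ , v y ⟩ →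
      M x y ≡ false → InBall i (shift ζ (- 1ℚ) y) x
    inBall-nonNeighbour {i} {ζ} {x} {y} in-ball C≤ζv Mxy =
      subst (λ s → s + C ≤ C * ι i)
        (sym (trans (shift-norm ζ (- 1ℚ) x y)
          (cong (λ m → S + (- (2ℚ * - 1ℚ) * (2ℚ * C * ind m - ⟨ ζ , v y ⟩) + - 1ℚ * - 1ℚ * ⟨ v y , v y ⟩)) Mxy)))
        (≤-by (0≤+ (0≤diff in-ball) (0≤+ (0≤* (nonNegative⁻¹ 2ℚ) (0≤diff C≤ζv)) (0≤diff (∣v∣²≤C y))))
          (solve 5 (λ C i S z w →
            C :* (con 1ℚ :+ i) :- (S :+ C) :+ (con 2ℚ :* (z :- C) :+ (C :- w)) :=
            C :* i :- (S :+ ((:- (con 2ℚ :* (:- con 1ℚ))) :* (con 2ℚ :* C :* con 0ℚ :- z) :+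
              (:- con 1ℚ) :* (:- con 1ℚ) :* w) :+ C)) refl C (ι i) S ⟨ ζ , v y ⟩ ⟨ v y , v y ⟩))
      where
      S : ℚ
      S = ⟨ offset ζ x , offset ζ x ⟩

    -- With centre 0 the left side is 4C²|u x|² + C ≤ C(4RC + 1), so a starting index exists that
    -- depends on Γ only.
    inBall-initial : ∀ {i} → 4ℚ * Γ + 1ℚ ≤ ι i → ∀ x → InBall i (λ _ → 0ℚ) x
    inBall-initial {i} 4Γ+1≤i x = begin
      ⟨ offset (λ _ → 0ℚ) x , offset (λ _ → 0ℚ) x ⟩ + C
        ≡⟨ cong (_+ C) (trans (∑-cong coordinates (λ l → solve 2 (λ C u →
             (con 2ℚ :* C :* u :- con 0ℚ) :* (con 2ℚ :* C :* u :- con 0ℚ) :=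
             con 4ℚ :* (C :* C) :* (u :* u)) refl C (u x l)))
             (∑-*ˡ coordinates (4ℚ * (C * C)) _)) ⟩
      4ℚ * (C * C) * ⟨ u x , u x ⟩ + C
        ≤⟨ +-monoˡ-≤ C (*-monoˡ-≤ (0≤* (nonNegative⁻¹ 4ℚ) (0≤² C)) (∣u∣²≤R x)) ⟩
      4ℚ * (C * C) * R + C
        ≡⟨ solve 2 (λ C R → con 4ℚ :* (C :* C) :* R :+ C := C :* (con 4ℚ :* (R :* C) :+ con 1ℚ)) refl C R ⟩
      C * (4ℚ * (R * C) + 1ℚ)
        ≤⟨ *-monoˡ-≤ (<⇒≤ 0<C) (≤-trans (+-monoˡ-≤ 1ℚ (*-monoˡ-≤ (nonNegative⁻¹ 4ℚ) RC≤Γ)) 4Γ+1≤i) ⟩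
      C * ι i ∎
      where open ≤-Reasoning

  -- i and j index the radii for rows and columns. Adding the two preceding bounds gives one f that
  -- serves both directions; the first summand pays for the locally sparse core, the doubled one for
  -- exceptional rows and exceptional columns. At index 0 one side is empty.
  sparsity : (Γ T : ℚ) → ℕ → ℕ → ℚ
  sparsity Γ T zero    j       = 0ℚ
  sparsity Γ T (suc i) zero    = 0ℚ
  sparsity Γ T (suc i) (suc j) = 8κ²Γ+1 Γ f + 2ℚ * (T * (f + 1ℚ))
    where
    f : ℚ
    f = sparsity Γ T i (suc j) + sparsity Γ T (suc i) j

  module Descent {A B : Set} {M : A → B → Bool} {Γ : ℚ} (φ : BoundedFactorization M Γ)
    {t : ℕ} (free : NoBiclique t M) where
    private
      module φ = BoundedFactorization φ
      module X = Balls φ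
      module Y = Balls (transpose φ)

      bound : ℕ → ℕ → ℚ
      bound = sparsity Γ (ι t)

      0≤Γ : 0ℚ ≤ Γ
      0≤Γ = ≤-trans (<⇒≤ (0<* φ.0<R φ.0<C)) φ.RC≤Γ

      bound-nonneg : ∀ i j → 0ℚ ≤ bound i j
      bound-nonneg zero    j       = ≤-refl
      bound-nonneg (suc i) zero    = ≤-refl
      bound-nonneg (suc i) (suc j) = 0≤+
        (0≤+ (0≤* (nonNegative⁻¹ 8ℚ) (0≤* (0≤² (κ f)) 0≤Γ)) (nonNegative⁻¹ 1ℚ))
        (0≤* (nonNegative⁻¹ 2ℚ) (0≤* (ι-nonneg t) (0≤+ 0≤f (nonNegative⁻¹ 1ℚ))))
        where
        f : ℚ
        f = bound i (suc j) + bound (suc i) j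
        0≤f : 0ℚ ≤ f
        0≤f = 0≤+ (bound-nonneg i (suc j)) (bound-nonneg (suc i) j)

      combine : ∀ e e₁ e₂ e₃ F E x y x₂ y₁ y₂ → 0ℚ ≤ F → 0ℚ ≤ E → x₂ ≤ x → y₁ ≤ y → y₂ ≤ y →
        e ≡ e₂ + (e₁ + e₃) → e₁ ≤ E * (y₁ + x₂) → e₂ ≤ E * (x + y₂) → e₃ ≤ F * (x + y) →
        e ≤ (F + 2ℚ * E) * (x + y)
      combine _ e₁ e₂ e₃ F E x y x₂ y₁ y₂ 0≤F 0≤E x₂≤x y₁≤y y₂≤y refl e₁≤ e₂≤ e₃≤ =
        ≤-by (0≤+ (0≤+ (0≤diff e₁≤) (0≤+ (0≤diff e₂≤) (0≤diff e₃≤)))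
            (0≤* 0≤E (0≤+ (0≤diff x₂≤x) (0≤+ (0≤diff y₁≤y) (0≤diff y₂≤y)))))
          (solve 10 (λ e₁ e₂ e₃ F E x y x₂ y₁ y₂ →
            (E :* (y₁ :+ x₂) :- e₁) :+ ((E :* (x :+ y₂) :- e₂) :+ (F :* (x :+ y) :- e₃)) :+
              E :* ((x :- x₂) :+ ((y :- y₁) :+ (y :- y₂))) :=
            (F :+ con 2ℚ :* E) :* (x :+ y) :- (e₂ :+ (e₁ :+ e₃)))
            refl e₁ e₂ e₃ F E x y x₂ y₁ y₂)

    edges-in-balls : ∀ i j {X Y ζ η} → Unique X → Unique Y →
      All (X.InBall i ζ) X → All (Y.InBall j η) Y →
      edges M X Y ≤ bound i j * (size X + size Y)
    edges-in-balls zero    j {[]} {Y} _ _ _ _ =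
      ≤-reflexive (sym (*-zeroˡ (0ℚ + size Y)))
    edges-in-balls zero    j {x ∷ _} {ζ = ζ} _ _ (in₀ ∷ _) _ =
      contradiction in₀ (X.¬inBall₀ {ζ} {x})
    edges-in-balls (suc i) zero {X} {[]} _ _ _ _ =
      ≤-reflexive (trans (∑-zero X) (sym (*-zeroˡ (size X + 0ℚ))))
    edges-in-balls (suc i) zero {Y = y ∷ _} {η = η} _ _ _ (in₀ ∷ _) =
      contradiction in₀ (Y.¬inBall₀ {η} {y})
    edges-in-balls (suc i) (suc j) {X} {Y} {ζ} {η} !X !Y X-in Y-in =
      -- The ones are divided among X × Y₂, X₂ × Y₁ and X₁ × Y₁, where index 2 marks the columns and
      -- rows above their threshold; only X₁ × Y₁ is locally sparse from both sides.
      combine (edges M X Y) (edges M X₂ Y₁) (edges M X Y₂) (edges M X₁ Y₁)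
        (8κ²Γ+1 Γ f) (ι t * (f + 1ℚ)) (size X) (size Y) (size X₂) (size Y₁) (size Y₂)
        (0≤+ (0≤* (nonNegative⁻¹ 8ℚ) (0≤* (0≤² (κ f)) 0≤Γ)) (nonNegative⁻¹ 1ℚ))
        (0≤* (ι-nonneg t) (0≤+ 0≤f (nonNegative⁻¹ 1ℚ)))
        (size-⊆ X₂⊆X) (size-⊆ Y₁⊆Y) (size-⊆ Y₂⊆Y)
        (trans (edges-splitʳ M y? X Y) (cong (edges M X Y₂ +_) (∑-split x? X _)))
        (subst (_≤ ι t * (f + 1ℚ) * (size Y₁ + size X₂)) (sym (edges-flip M X₂ Y₁))
          (Exceptional.exceptional-bound (noBiclique-flip {M = M} free) 0≤f X₂ (unique-⊆ X₂⊆X !X)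
            Y₁ (unique-⊆ Y₁⊆Y !Y) exceptional-rows))
        (Exceptional.exceptional-bound free 0≤f Y₂ (unique-⊆ Y₂⊆Y !Y) X !X exceptional-columns)
        (≤-trans (locallySparse⇒edges-bound φ 0≤f column-sparse row-sparse)
          (*-monoˡ-≤ (0≤+ (0≤* (nonNegative⁻¹ 8ℚ) (0≤* (0≤² (κ f)) 0≤Γ)) (nonNegative⁻¹ 1ℚ))
            (+-mono-≤ (size-⊆ X₁⊆X) (size-⊆ Y₁⊆Y))))
      where
      f : ℚ
      f = bound i (suc j) + bound (suc i) j
      0≤f : 0ℚ ≤ f
      0≤f = 0≤+ (bound-nonneg i (suc j)) (bound-nonneg (suc i) j)

      y? : Decidable (λ y → φ.C < X.⟨ ζ , φ.v y ⟩)
      y? y = φ.C <? X.⟨ ζ , φ.v y ⟩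
      x? : Decidable (λ x → φ.R < X.⟨ η , φ.u x ⟩)
      x? x = φ.R <? X.⟨ η , φ.u x ⟩
      X₁ X₂ : List A
      X₁ = filter (∁? x?) X
      X₂ = filter x? X
      Y₁ Y₂ : List B
      Y₁ = filter (∁? y?) Y
      Y₂ = filter y? Y
      X₁⊆X : X₁ ⊆ X
      X₁⊆X = filter-⊆ (∁? x?) X
      X₂⊆X : X₂ ⊆ X
      X₂⊆X = filter-⊆ x? X
      Y₁⊆Y : Y₁ ⊆ Y
      Y₁⊆Y = filter-⊆ (∁? y?) Y
      Y₂⊆Y : Y₂ ⊆ Y
      Y₂⊆Y = filter-⊆ y? Y

      -- The induction hypothesis in i: the rows fit a smaller ball around any new centre, while the
      -- columns keep theirs.
      fewer-rows : ∀ {X′ Y′ ζ′} → X′ ⊆ X → Y′ ⊆ Y → All (X.InBall i ζ′) X′ →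
        edges M X′ Y′ ≤ f * (size X′ + size Y′)
      fewer-rows {X′} {Y′} X′⊆X Y′⊆Y X′-in = ≤-trans
        (edges-in-balls i (suc j) (unique-⊆ X′⊆X !X) (unique-⊆ Y′⊆Y !Y) X′-in (All-resp-⊆ Y′⊆Y Y-in))
        (*-monoʳ-≤ (0≤+ (size-nonneg X′) (size-nonneg Y′))
          (p≤p+q (bound i (suc j)) (bound-nonneg (suc i) j)))

      fewer-columns : ∀ {X′ Y′ η′} → X′ ⊆ X → Y′ ⊆ Y → All (Y.InBall j η′) Y′ →
        edges (flip M) Y′ X′ ≤ f * (size Y′ + size X′)
      fewer-columns {X′} {Y′} X′⊆X Y′⊆Y Y′-in = subst₂ _≤_ (edges-flip M X′ Y′)
        (cong (f *_) (+-comm (size X′) (size Y′))) (≤-trans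
          (edges-in-balls (suc i) j (unique-⊆ X′⊆X !X) (unique-⊆ Y′⊆Y !Y) (All-resp-⊆ X′⊆X X-in) Y′-in)
          (*-monoʳ-≤ (0≤+ (size-nonneg X′) (size-nonneg Y′))
            (p≤q+p (bound (suc i) j) (bound-nonneg i (suc j)))))

      column-sparse : LocallySparse M f X₁ Y₁
      column-sparse {y = y} X′⊆ Y′⊆ y∈ adj = fewer-rows (⊆-trans X′⊆ X₁⊆X) (⊆-trans Y′⊆ Y₁⊆Y)
        (All.zipWith (λ {x} (in-ball , Mxy) → X.inBall-neighbour {i} {ζ} {x} {y} in-ball
            (≮⇒≥ (proj₂ (∈-filter⁻ (∁? y?) {xs = Y} y∈))) Mxy)
          (All-resp-⊆ (⊆-trans X′⊆ X₁⊆X) X-in , adj))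

      row-sparse : LocallySparse (flip M) f Y₁ X₁
      row-sparse {y = x} Y′⊆ X′⊆ x∈ adj = fewer-columns (⊆-trans X′⊆ X₁⊆X) (⊆-trans Y′⊆ Y₁⊆Y)
        (All.zipWith (λ {y} (in-ball , Mxy) → Y.inBall-neighbour {j} {η} {y} {x} in-ball
            (≮⇒≥ (proj₂ (∈-filter⁻ (∁? x?) {xs = X} x∈))) Mxy)
          (All-resp-⊆ (⊆-trans Y′⊆ Y₁⊆Y) Y-in , adj))

      exceptional-columns : ∀ {X′ y} → X′ ⊆ X → y ∈ Y₂ → All (λ x → M x y ≡ false) X′ →
        edges M X′ Y₂ ≤ f * (size X′ + size Y₂)
      exceptional-columns {y = y} X′⊆X y∈ nonadj = fewer-rows X′⊆X Y₂⊆Y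
        (All.zipWith (λ {x} (in-ball , Mxy) → X.inBall-nonNeighbour {i} {ζ} {x} {y} in-ball
            (<⇒≤ (proj₂ (∈-filter⁻ y? {xs = Y} y∈))) Mxy)
          (All-resp-⊆ X′⊆X X-in , nonadj))

      exceptional-rows : ∀ {Y′ x} → Y′ ⊆ Y₁ → x ∈ X₂ → All (λ y → M x y ≡ false) Y′ →
        edges (flip M) Y′ X₂ ≤ f * (size Y′ + size X₂)
      exceptional-rows {x = x} Y′⊆ x∈ nonadj = fewer-columns X₂⊆X (⊆-trans Y′⊆ Y₁⊆Y)
        (All.zipWith (λ {y} (in-ball , Mxy) → Y.inBall-nonNeighbour {j} {η} {y} {x} in-ball
            (<⇒≤ (proj₂ (∈-filter⁻ x? {xs = X} x∈))) Mxy)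
          (All-resp-⊆ (⊆-trans Y′⊆ Y₁⊆Y) Y-in , nonadj))

  -- Natural numbers in ℚ, and sums over finite index sets

  ι-+ : ∀ m n → ι (m ℕ.+ n) ≡ ι m + ι n
  ι-+ zero    n = sym (+-identityˡ (ι n))
  ι-+ (suc m) n = trans (cong (1ℚ +_) (ι-+ m n)) (sym (+-assoc 1ℚ (ι m) (ι n)))

  ι-* : ∀ m n → ι (m ℕ.* n) ≡ ι m * ι n
  ι-* zero    n = sym (*-zeroˡ (ι n))
  ι-* (suc m) n = trans (ι-+ n (m ℕ.* n)) (trans (cong (ι n +_) (ι-* m n))
    (solve 2 (λ m n → n :+ m :* n := (con 1ℚ :+ m) :* n) refl (ι m) (ι n)))

  ι-cancel-≤ : ∀ {m n} → ι m ≤ ι n → m ℕ.≤ n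
  ι-cancel-≤ {m} {n} ιm≤ιn = ℕₚ.≮⇒≥ λ n<m → <-irrefl refl
    (<-≤-trans (<-≤-trans (subst (_< 1ℚ + ι n) (+-identityˡ (ι n)) (+-monoˡ-< (ι n) (positive⁻¹ 1ℚ)))
      (ι-mono-≤ n<m)) ιm≤ιn)

  toℚᵘ-ι : ∀ n → toℚᵘ (ι n) ℚᵘ.≃ ℚᵘ.mkℚᵘ (ℤ.+ n) 0
  toℚᵘ-ι zero    = ℚᵘₚ.≃-refl
  toℚᵘ-ι (suc n) = ℚᵘₚ.≃-trans (toℚᵘ-homo-+ 1ℚ (ι n)) (ℚᵘₚ.≃-trans
    (ℚᵘₚ.+-congʳ ℚᵘ.1ℚᵘ (toℚᵘ-ι n))
    (ℚᵘ.*≡* (cong (ℤ._* ℤ.1ℤ) (cong (λ k → ℤ.1ℤ ℤ.+ k) (ℤₚ.*-identityʳ (ℤ.+ n))))))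

  abstract
    archimedean : ∀ q → ∃[ n ] q ≤ ι n
    archimedean q@(mkℚ z d _) = ℤ.∣ z ∣ , toℚᵘ-cancel-≤ (ℚᵘₚ.≤-respʳ-≃ (ℚᵘₚ.≃-sym (toℚᵘ-ι ℤ.∣ z ∣))
      (ℚᵘ.*≤* (ℤₚ.≤-trans (ℤₚ.≤-reflexive (ℤₚ.*-identityʳ z)) (z≤∣z∣*d z))))
      where
      z≤∣z∣*d : ∀ z → z ℤ.≤ ℤ.+ ℤ.∣ z ∣ ℤ.* ℤ.+ suc d
      z≤∣z∣*d (ℤ.+ n) = subst (ℤ.+ n ℤ.≤_) (ℤₚ.pos-* n (suc d)) (ℤ.+≤+ (ℕₚ.m≤m*n n (suc d)))
      z≤∣z∣*d ℤ.-[1+ n ] = subst (ℤ.-[1+ n ] ℤ.≤_) (ℤₚ.pos-* (suc n) (suc d)) ℤ.-≤+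

  ∑-allFin-suc : ∀ {n} (f : Fin (suc n) → ℚ) →
    ∑ (allFin (suc n)) f ≡ f Fin.zero + ∑ (allFin n) (f ∘ Fin.suc)
  ∑-allFin-suc {n} f = cong (f Fin.zero +_)
    (trans (cong (λ X → ∑ X f) (sym (map-tabulate id Fin.suc))) (∑-map Fin.suc (allFin n) f))

  size-allFin : ∀ n → size (allFin n) ≡ ι n
  size-allFin n = trans (size≡ι (allFin n)) (cong ι (length-tabulate {n = n} id))

  δ : ∀ {n} → Fin n → Fin n → ℚ
  δ i j = ind (does (i Finₚ.≟ j))

  ∑-δ : ∀ {n} (f : Fin n → ℚ) i → ∑ (allFin n) (λ j → f j * δ i j) ≡ f i
  ∑-δ {suc n} f Fin.zero = trans (∑-allFin-suc (λ j → f j * δ Fin.zero j)) (begin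
    f Fin.zero * 1ℚ + ∑ (allFin n) (λ j → f (Fin.suc j) * 0ℚ)
      ≡⟨ cong₂ _+_ (*-identityʳ (f Fin.zero)) (trans (∑-*ʳ (allFin n) 0ℚ (f ∘ Fin.suc)) (*-zeroʳ (∑ (allFin n) (f ∘ Fin.suc)))) ⟩
    f Fin.zero + 0ℚ
      ≡⟨ +-identityʳ (f Fin.zero) ⟩
    f Fin.zero ∎)
    where open ≡-Reasoning
  ∑-δ {suc n} f (Fin.suc i) = trans (∑-allFin-suc (λ j → f j * δ (Fin.suc i) j)) (begin
    f Fin.zero * 0ℚ + ∑ (allFin n) (λ j → f (Fin.suc j) * δ i j)
      ≡⟨ cong₂ _+_ (*-zeroʳ (f Fin.zero)) (∑-δ (f ∘ Fin.suc) i) ⟩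
    0ℚ + f (Fin.suc i)
      ≡⟨ +-identityˡ (f (Fin.suc i)) ⟩
    f (Fin.suc i) ∎)
    where open ≡-Reasoning

  ι-sum : ∀ {n} (f : Fin n → ℕ) →
    ι (monoidSum ℕ.+-0-rawMonoid f) ≡ ∑ (allFin n) (ι ∘ f)
  ι-sum {zero}  f = refl
  ι-sum {suc n} f = trans (ι-+ (f Fin.zero) _)
    (trans (cong (ι (f Fin.zero) +_) (ι-sum (f ∘ Fin.suc))) (sym (∑-allFin-suc (ι ∘ f))))

  seq-∑ : ∀ {k} (f : Fin k → ℝ) n → seq (Defs.∑ f) n ≡ ∑ (allFin k) (λ l → seq (f l) n)
  seq-∑ {zero}  f n = refl
  seq-∑ {suc k} f n = trans (cong (seq (f Fin.zero) n +_) (seq-∑ (f ∘ Fin.suc) n))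
    (sym (∑-allFin-suc (λ l → seq (f l) n)))

  numOnes≡edges : ∀ {m n} (M : BoolMatrix m n) → ι (numOnes M) ≡ edges M (allFin m) (allFin n)
  numOnes≡edges {m} {n} M = trans (ι-sum (λ i → monoidSum ℕ.+-0-rawMonoid (one i)))
    (∑-cong (allFin m) (λ i → trans (ι-sum (one i)) (∑-cong (allFin n) (λ j → ι-if (M i j)))))
    where
    one : Fin m → Fin n → ℕ
    one i j = if M i j then 1 else 0
    ι-if : ∀ b → ι (if b then 1 else 0) ≡ ind b
    ι-if true  = refl
    ι-if false = refl

  -- Lists without repetition as subsets

  fromList : ∀ {n} → List (Fin n) → Subset n
  fromList []      = Subset.⊥
  fromList (x ∷ X) = fromList X [ x ]≔ true

  insert⁻ : ∀ {n} (p : Subset n) {i j} → i Subset.∈ (p [ j ]≔ true) → i ≡ j ⊎ i Subset.∈ p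
  insert⁻ (_ ∷ p) {Fin.zero}  {Fin.zero}  _              = inj₁ refl
  insert⁻ (_ ∷ p) {Fin.zero}  {Fin.suc j} Vec.here       = inj₂ Vec.here
  insert⁻ (_ ∷ p) {Fin.suc i} {Fin.zero}  (Vec.there i∈) = inj₂ (Vec.there i∈)
  insert⁻ (_ ∷ p) {Fin.suc i} {Fin.suc j} (Vec.there i∈) with insert⁻ p i∈
  ... | inj₁ i≡j = inj₁ (cong Fin.suc i≡j)
  ... | inj₂ i∈p = inj₂ (Vec.there i∈p)

  ∣insert∣ : ∀ {n} (p : Subset n) {j} → ¬ j Subset.∈ p →
    Subset.∣ p [ j ]≔ true ∣ ≡ suc Subset.∣ p ∣
  ∣insert∣ (true  ∷ p) {Fin.zero}  j∉ = contradiction Vec.here j∉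
  ∣insert∣ (false ∷ p) {Fin.zero}  j∉ = refl
  ∣insert∣ (true  ∷ p) {Fin.suc j} j∉ = cong suc (∣insert∣ p (j∉ ∘ Vec.there))
  ∣insert∣ (false ∷ p) {Fin.suc j} j∉ = ∣insert∣ p (j∉ ∘ Vec.there)

  ∈-fromList⁻ : ∀ {n} (X : List (Fin n)) {i} → i Subset.∈ fromList X → i ∈ X
  ∈-fromList⁻ []      i∈ = contradiction i∈ Subsetₚ.∉⊥
  ∈-fromList⁻ (x ∷ X) i∈ with insert⁻ (fromList X) i∈
  ... | inj₁ i≡x = here i≡x
  ... | inj₂ i∈X = there (∈-fromList⁻ X i∈X)

  ∣fromList∣ : ∀ {n} {X : List (Fin n)} → Unique X → Subset.∣ fromList X ∣ ≡ length X
  ∣fromList∣ {n} []          = Subsetₚ.∣⊥∣≡0 n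
  ∣fromList∣ {X = x ∷ X} (x∉X ∷ !X) = trans
    (∣insert∣ (fromList X) (λ x∈ → All.lookup x∉X (∈-fromList⁻ X x∈) refl))
    (cong suc (∣fromList∣ !X))

  noBiclique : ∀ {m n t} {M : BoolMatrix m n} → ¬ HasAllOnesSubmatrix t M → NoBiclique t M
  noBiclique no-ones {X} {Y} !X !Y ∣X∣≡t ∣Y∣≡t all-ones = no-ones
    ( fromList X , fromList Y , trans (∣fromList∣ !X) ∣X∣≡t , trans (∣fromList∣ !Y) ∣Y∣≡t
    , λ i∈ j∈ → all-ones (∈-fromList⁻ X i∈) (∈-fromList⁻ Y j∈))

  -- From real to rational factorizations

  p≤∣p∣ : ∀ p → p ≤ ∣ p ∣
  p≤∣p∣ p with ∣p∣≡p∨∣p∣≡-p p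
  ... | inj₁ ∣p∣≡p  = ≤-reflexive (sym ∣p∣≡p)
  ... | inj₂ ∣p∣≡-p = ≤-trans (subst (_≤ 0ℚ)
    (trans (cong -_ ∣p∣≡-p) (solve 1 (λ p → :- (:- p) := p) refl p))
    (neg-antimono-≤ (0≤∣p∣ p))) (0≤∣p∣ p)

  ∣p∣<⇒p< : ∀ {p ε} → ∣ p ∣ < ε → p < ε
  ∣p∣<⇒p< {p} = ≤-<-trans (p≤∣p∣ p)

  ∣p∣<⇒-p< : ∀ {p ε} → ∣ p ∣ < ε → - p < ε
  ∣p∣<⇒-p< {p} ∣p∣<ε = ∣p∣<⇒p< (subst (_< _) (sym (∣-p∣≡∣p∣ p)) ∣p∣<ε)

  ∣p∣<-intro : ∀ {p ε} → p < ε → - p < ε → ∣ p ∣ < ε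
  ∣p∣<-intro {p} {ε} p<ε -p<ε with ∣p∣≡p∨∣p∣≡-p p
  ... | inj₁ ∣p∣≡p  = subst (_< ε) (sym ∣p∣≡p) p<ε
  ... | inj₂ ∣p∣≡-p = subst (_< ε) (sym ∣p∣≡-p) -p<ε

  <⇒-< : ∀ {a b c} → a < b + c → a - b < c
  <⇒-< {a} {b} {c} a<b+c = subst (a - b <_)
    (solve 2 (λ b c → b :+ c :- b := c) refl b c) (+-monoˡ-< (- b) a<b+c)

  -<⇒< : ∀ {a b c} → a - b < c → a < b + c
  -<⇒< {a} {b} {c} a-b<c = subst (_< b + c)
    (solve 2 (λ a b → b :+ (a :- b) := a) refl a b) (+-monoʳ-< b a-b<c)

  Eventually : (ℕ → Set) → Set
  Eventually P = ∃[ N ] (∀ n → N ℕ.≤ n → P n)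

  eventually-× : ∀ {P Q} → Eventually P → Eventually Q → Eventually (λ n → P n × Q n)
  eventually-× (N₁ , p) (N₂ , q) = N₁ ℕ.⊔ N₂ , λ n N≤n →
    p n (ℕₚ.m⊔n≤o⇒m≤o N₁ N₂ N≤n) , q n (ℕₚ.m⊔n≤o⇒n≤o N₁ N₂ N≤n)

  eventually-map : ∀ {P Q : ℕ → Set} → (∀ n → P n → Q n) → Eventually P → Eventually Q
  eventually-map f (N , p) = N , λ n N≤n → f n (p n N≤n)

  eventually-∀ : ∀ {m} {P : Fin m → ℕ → Set} → (∀ i → Eventually (P i)) →
    Eventually (λ n → ∀ i → P i n)
  eventually-∀ {zero}  p = 0 , λ _ _ ()
  eventually-∀ {suc m} p = eventually-map
    (λ { n (p₀ , ps) Fin.zero → p₀ ; n (p₀ , ps) (Fin.suc i) → ps i })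
    (eventually-× (p Fin.zero) (eventually-∀ (λ i → p (Fin.suc i))))

  bounded-above : ∀ {x} → IsCauchy x → ∃[ k ] Eventually (λ n → x n ≤ ι k)
  bounded-above {x} cx =
    let N , close = cx 1ℚ (positive⁻¹ 1ℚ)
        k , xN+1≤k = archimedean (x N + 1ℚ)
    in k , N , λ n N≤n → ≤-trans
         (<⇒≤ (-<⇒< {x n} {x N} (∣p∣<⇒p< (close n N N≤n ℕₚ.≤-refl)))) xN+1≤k

  private
    0<ι-suc : ∀ n → 0ℚ < ι (suc n)
    0<ι-suc n = <-≤-trans (positive⁻¹ 1ℚ) (p≤p+q 1ℚ (ι-nonneg n))

  -- 1/(n + 1). It is the accuracy of the n-th approximate root, and later the share of each of n +
  -- 1 columns in the error.
  ν : ℕ → ℚ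
  ν n = proj₁ (reciprocal (0<ι-suc n))

  0<ν : ∀ n → 0ℚ < ν n
  0<ν n = proj₁ (proj₂ (reciprocal (0<ι-suc n)))

  ι*ν≡1 : ∀ n → ι (suc n) * ν n ≡ 1ℚ
  ι*ν≡1 n = proj₂ (proj₂ (reciprocal (0<ι-suc n)))

  ν≤1 : ∀ n → ν n ≤ 1ℚ
  ν≤1 n = subst₂ _≤_ (*-identityˡ (ν n)) (ι*ν≡1 n)
    (*-monoʳ-≤ (<⇒≤ (0<ν n)) (p≤p+q 1ℚ (ι-nonneg n)))

  ν-small : ∀ {ε} → 0ℚ < ε → Eventually (λ n → ν n ≤ ε)
  ν-small {ε} 0<ε =
    let r , _ , εr≡1 = reciprocal 0<ε
        N , r≤N = archimedean r
    in N , λ n N≤n → begin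
      ν n                   ≡⟨ trans (sym (*-identityʳ (ν n))) (cong (ν n *_) (sym εr≡1)) ⟩
      ν n * (ε * r)         ≤⟨ *-monoˡ-≤ (<⇒≤ (0<ν n)) (*-monoˡ-≤ (<⇒≤ 0<ε)
                                 (≤-trans r≤N (ι-mono-≤ (ℕₚ.m≤n⇒m≤1+n N≤n)))) ⟩
      ν n * (ε * ι (suc n)) ≡⟨ solve 3 (λ v e i → v :* (e :* i) := e :* (i :* v)) refl (ν n) ε (ι (suc n)) ⟩
      ε * (ι (suc n) * ν n) ≡⟨ trans (cong (ε *_) (ι*ν≡1 n)) (*-identityʳ ε) ⟩
      ε                     ∎
    where open ≤-Reasoning

  abstract
    -- Descends through the multiples kd until the square is at most q, starting where kd ≥ 1 + q
    -- and hence (kd)² > q.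
    approximate-sqrt : ∀ q → 0ℚ ≤ q → ∀ d → 0ℚ < d →
      ∃[ b ] 0ℚ ≤ b × b * b ≤ q × q < (b + d) * (b + d)
    approximate-sqrt q 0≤q d 0<d =
      let r , _ , dr≡1 = reciprocal 0<d
          k , [1+q]r≤k = archimedean ((1ℚ + q) * r)
      in search k (begin-strict
        q                         <⟨ subst (_< 1ℚ + q) (+-identityˡ q) (+-monoˡ-< q (positive⁻¹ 1ℚ)) ⟩
        1ℚ + q                    ≤⟨ ≤-by (0≤+ 0≤q (0≤² q)) (solve 1 (λ q → q :+ q :* q :=
                                       (con 1ℚ :+ q) :* (con 1ℚ :+ q) :- (con 1ℚ :+ q)) refl q) ⟩
        (1ℚ + q) * (1ℚ + q)       ≤⟨ square-mono (0≤+ (nonNegative⁻¹ 1ℚ) 0≤q) (begin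
          1ℚ + q                    ≡⟨ trans (sym (*-identityʳ (1ℚ + q))) (cong ((1ℚ + q) *_) (sym dr≡1)) ⟩
          (1ℚ + q) * (d * r)        ≡⟨ solve 3 (λ p d r → p :* (d :* r) := p :* r :* d) refl (1ℚ + q) d r ⟩
          (1ℚ + q) * r * d          ≤⟨ *-monoʳ-≤ (<⇒≤ 0<d) [1+q]r≤k ⟩
          ι k * d                   ∎) ⟩
        ι k * d * (ι k * d)       ∎)
      where
      open ≤-Reasoning
      square-mono : ∀ {a b} → 0ℚ ≤ a → a ≤ b → a * a ≤ b * b
      square-mono 0≤a a≤b = *-mono-≤ 0≤a (≤-trans 0≤a a≤b) a≤b a≤b
      search : ∀ k → q < ι k * d * (ι k * d) →
        ∃[ b ] 0ℚ ≤ b × b * b ≤ q × q < (b + d) * (b + d)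
      search zero    q<0 = contradiction
        (≤-<-trans 0≤q (subst (q <_) (solve 1 (λ d → con 0ℚ :* d :* (con 0ℚ :* d) := con 0ℚ) refl d) q<0))
        (<-irrefl refl)
      search (suc k) q< = cases (q <? ι k * d * (ι k * d))
        where
        cases : Dec (q < ι k * d * (ι k * d)) → ∃[ b ] 0ℚ ≤ b × b * b ≤ q × q < (b + d) * (b + d)
        cases (yes q<k) = search k q<k
        cases (no q≮k)  = ι k * d , 0≤* (ι-nonneg k) (<⇒≤ 0<d) , ≮⇒≥ q≮k ,
          subst (q <_) (solve 2 (λ k d → (con 1ℚ :+ k) :* d :* ((con 1ℚ :+ k) :* d) :=
                                         (k :* d :+ d) :* (k :* d :+ d)) refl (ι k) d) q<

  -- A maximum bounds only reals that have been exhibited as norms, so the norm of each row has to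
  -- be constructed before the maximum says anything about that row.
  module SquareRoot (x : ℝ) (0≤x : ∀ n → 0ℚ ≤ seq x n) where
    private
      root : ∀ n → ∃[ b ] 0ℚ ≤ b × b * b ≤ seq x n × seq x n < (b + ν n) * (b + ν n)
      root n = approximate-sqrt (seq x n) (0≤x n) (ν n) (0<ν n)

      b : ℕ → ℚ
      b n = proj₁ (root n)

    0≤root : ∀ n → 0ℚ ≤ b n
    0≤root n = proj₁ (proj₂ (root n))

    private
      b²≤x : ∀ n → b n * b n ≤ seq x n
      b²≤x n = proj₁ (proj₂ (proj₂ (root n)))

      x<[b+ν]² : ∀ n → seq x n < (b n + ν n) * (b n + ν n)
      x<[b+ν]² n = proj₂ (proj₂ (proj₂ (root n)))

      -- Otherwise b_n² ≥ (b_m + ε)² ≥ (b_m + ε/2)² + ε²/2 > x_n. The tolerance ε²/2 is independent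
      -- of the size of the root, so roots near 0 are covered.
      close : ∀ {ε} → 0ℚ < ε → ∀ m n → seq x n - seq x m < ½ * (ε * ε) → ν m ≤ ½ * ε →
        b n < b m + ε
      close {ε} 0<ε m n x-close ν≤ = ≰⇒> λ b+ε≤b → <-irrefl refl (begin-strict
        seq x n
          <⟨ -<⇒< {seq x n} {seq x m} x-close ⟩
        seq x m + ½ * (ε * ε)
          <⟨ +-monoˡ-< (½ * (ε * ε)) (x<[b+ν]² m) ⟩
        (b m + ν m) * (b m + ν m) + ½ * (ε * ε)
          ≤⟨ +-monoˡ-≤ (½ * (ε * ε)) (*-mono-≤ 0≤b+ν (≤-trans 0≤b+ν b+ν≤) b+ν≤ b+ν≤) ⟩
        (b m + ½ * ε) * (b m + ½ * ε) + ½ * (ε * ε)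
          ≤⟨ ≤-by (0≤+ (0≤* (0≤root m) (<⇒≤ 0<ε)) (0≤² (½ * ε))) (solve 2 (λ b e →
               b :* e :+ con ½ :* e :* (con ½ :* e) := (b :+ e) :* (b :+ e) :-
                 ((b :+ con ½ :* e) :* (b :+ con ½ :* e) :+ con ½ :* (e :* e))) refl (b m) ε) ⟩
        (b m + ε) * (b m + ε)
          ≤⟨ *-mono-≤ 0≤b+ε (0≤root n) b+ε≤b b+ε≤b ⟩
        b n * b n
          ≤⟨ b²≤x n ⟩
        seq x n ∎)
        where
        open ≤-Reasoning
        0≤b+ν : 0ℚ ≤ b m + ν m
        0≤b+ν = 0≤+ (0≤root m) (<⇒≤ (0<ν m))
        b+ν≤ : b m + ν m ≤ b m + ½ * ε
        b+ν≤ = +-monoʳ-≤ (b m) ν≤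
        0≤b+ε : 0ℚ ≤ b m + ε
        0≤b+ε = 0≤+ (0≤root m) (<⇒≤ 0<ε)

      root-cauchy : IsCauchy b
      root-cauchy ε 0<ε =
        let N₁ , x-close = cauchy x (½ * (ε * ε)) (0<* (positive⁻¹ ½) (0<* 0<ε 0<ε))
            N₂ , ν≤ = ν-small (0<* (positive⁻¹ ½) 0<ε)
        in N₁ ℕ.⊔ N₂ , λ m n N≤m N≤n →
          let m₁ = ℕₚ.m⊔n≤o⇒m≤o N₁ N₂ N≤m
              n₁ = ℕₚ.m⊔n≤o⇒m≤o N₁ N₂ N≤n
              m₂ = ℕₚ.m⊔n≤o⇒n≤o N₁ N₂ N≤m
              n₂ = ℕₚ.m⊔n≤o⇒n≤o N₁ N₂ N≤n
          in ∣p∣<-intro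
            (<⇒-< (close 0<ε n m (∣p∣<⇒p< (x-close m n m₁ n₁)) (ν≤ n n₂)))
            (subst (_< ε) (solve 2 (λ s t → t :- s := :- (s :- t)) refl (b m) (b n))
              (<⇒-< (close 0<ε m n (∣p∣<⇒p< (x-close n m n₁ m₁)) (ν≤ m m₂))))

    sqrt : ℝ
    sqrt = mkℝ b root-cauchy

    sqrt*sqrt≃ : (sqrt Defs.* sqrt) Defs.≃ x
    sqrt*sqrt≃ ε 0<ε =
      let k , b≤k = bounded-above {b} root-cauchy
          -- K bounds 2b + ν, so (b + ν)² - b² = ν(2b + ν) ≤ νK.
          K = 2ℚ * ι k + 1ℚ + 1ℚ
          0<K = <-≤-trans (positive⁻¹ 1ℚ) (p≤q+p 1ℚ
                  (0≤+ (0≤* (nonNegative⁻¹ 2ℚ) (ι-nonneg k)) (nonNegative⁻¹ 1ℚ)))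
          r , 0<r , Kr≡1 = reciprocal {K} 0<K
      in eventually-map (λ n (b≤k , ν≤) → ∣p∣<-intro
           (≤-<-trans (subst (b n * b n - seq x n ≤_) (+-inverseʳ (seq x n))
              (+-monoˡ-≤ (- seq x n) (b²≤x n))) 0<ε)
           (subst (_< ε) (solve 2 (λ s t → t :- s := :- (s :- t)) refl (b n * b n) (seq x n))
             (<⇒-< {seq x n} {b n * b n} (<-≤-trans (x<[b+ν]² n) (begin
               (b n + ν n) * (b n + ν n)
                 ≤⟨ ≤-by (0≤* (<⇒≤ (0<ν n)) (0≤+ (0≤+ (0≤* (nonNegative⁻¹ 2ℚ) (0≤diff b≤k))
                       (0≤diff (ν≤1 n))) (nonNegative⁻¹ 1ℚ)))
                     (solve 3 (λ b v k → v :* (con 2ℚ :* (k :- b) :+ (con 1ℚ :- v) :+ con 1ℚ) :=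
                       b :* b :+ v :* (con 2ℚ :* k :+ con 1ℚ :+ con 1ℚ) :- (b :+ v) :* (b :+ v))
                       refl (b n) (ν n) (ι k)) ⟩
               b n * b n + ν n * K
                 ≤⟨ +-monoʳ-≤ (b n * b n) (*-monoʳ-≤ (<⇒≤ 0<K) ν≤) ⟩
               b n * b n + ε * r * K
                 ≡⟨ cong (b n * b n +_) (trans (solve 3 (λ e r K → e :* r :* K := e :* (K :* r)) refl ε r K)
                      (trans (cong (ε *_) Kr≡1) (*-identityʳ ε))) ⟩
               b n * b n + ε ∎)))))
        (eventually-× b≤k (ν-small (0<* 0<ε 0<r)))
      where open ≤-Reasoning

  module _ {m k} (w : Fin m → Vector ℝ k) (r : ℝ)
    (r-max : IsMaximum (λ s → ∃[ i ] IsNorm (w i) s) r) where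

    private
      ∣_∣² : Fin m → ℕ → ℚ
      ∣ i ∣² n = ∑ (allFin k) (λ l → seq (w i l) n * seq (w i l) n)

      sum² : Fin m → ℝ
      sum² i = Defs.∑ (λ l → w i l Defs.* w i l)

      seq-sum² : ∀ i n → seq (sum² i) n ≡ ∣ i ∣² n
      seq-sum² i n = seq-∑ (λ l → w i l Defs.* w i l) n

      0≤sum² : ∀ i n → 0ℚ ≤ seq (sum² i) n
      0≤sum² i n = subst (0ℚ ≤_) (sym (seq-sum² i n))
        (∑-nonneg (allFin k) (λ {l} _ → 0≤² (seq (w i l) n)))

      norm : Fin m → ℝ
      norm i = SquareRoot.sqrt (sum² i) (0≤sum² i)

      0≤norm : ∀ i n → 0ℚ ≤ seq (norm i) n
      0≤norm i = SquareRoot.0≤root (sum² i) (0≤sum² i)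

      norm²≃ : ∀ i → (norm i Defs.* norm i) Defs.≃ sum² i
      norm²≃ i = SquareRoot.sqrt*sqrt≃ (sum² i) (0≤sum² i)

      norm≤r : ∀ i → norm i Defs.≤ r
      norm≤r i = proj₂ r-max (norm i)
        (i , (λ η 0<η → 0 , λ n _ → <-≤-trans 0<η (p≤q+p η (0≤norm i n))) , norm²≃ i)

      bound : ∀ {ε} s t r → 0ℚ ≤ s → ∣ s * s - t ∣ < ε → s < r + ε →
        0ℚ ≤ r + ε × t ≤ (r + ε) * (r + ε) + ε
      bound {ε} s t r 0≤s s²~t s<r+ε = 0≤r+ε , (begin
        t                         ≤⟨ <⇒≤ (-<⇒< {t} {s * s} (subst (_< ε)
                                       (solve 2 (λ s t → :- (s :- t) := t :- s) refl (s * s) t)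
                                       (∣p∣<⇒-p< s²~t))) ⟩
        s * s + ε                 ≤⟨ +-monoˡ-≤ ε (*-mono-≤ 0≤s 0≤r+ε (<⇒≤ s<r+ε) (<⇒≤ s<r+ε)) ⟩
        (r + ε) * (r + ε) + ε     ∎)
        where
        open ≤-Reasoning
        0≤r+ε : 0ℚ ≤ r + ε
        0≤r+ε = ≤-trans 0≤s (<⇒≤ s<r+ε)

    -- Each `norm i` competes in the maximum, so its terms are eventually below those of r + ε. The
    -- sign of r + ε is recorded because single terms of r may be negative.
    norms-eventually-bounded : ∀ {ε} → 0ℚ < ε → Eventually (λ n → ∀ i →
      0ℚ ≤ seq r n + ε ×
      ∑ (allFin k) (λ l → seq (w i l) n * seq (w i l) n) ≤ (seq r n + ε) * (seq r n + ε) + ε)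
    norms-eventually-bounded {ε} 0<ε = eventually-∀ λ i → eventually-map
      (λ n (s²~t , s<r+ε) → bound (seq (norm i) n) (∣ i ∣² n) (seq r n) (0≤norm i n)
        (subst (λ t → ∣ seq (norm i) n * seq (norm i) n - t ∣ < ε) (seq-sum² i n) s²~t) s<r+ε)
      (eventually-× {λ n → ∣ seq (norm i) n * seq (norm i) n - seq (sum² i) n ∣ < ε}
        {λ n → seq (norm i) n < seq r n + ε} (norm²≃ i ε 0<ε) (norm≤r i ε 0<ε))

  -- The value of Γ: G bounds the late terms of γ and is squared because R and C bound squared
  -- norms; the constants 2 make room for all errors of order ε.
  [G+2]²+2 : ℚ → ℚ
  [G+2]²+2 G = (G + 2ℚ) * (G + 2ℚ) + 2ℚ

  private
    -- B comes from the particular factorization and must not enter the result. With ε = 1/4(B + 1)²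
    -- the cross terms 2ε((r + ε)² + (c + ε)²) are at most 1, whatever B is.
    product-bound : ∀ B G ε r c → 0ℚ ≤ B → 0ℚ < ε → 4ℚ * ((B + 1ℚ) * (B + 1ℚ)) * ε ≡ 1ℚ →
      r ≤ B → c ≤ B → 0ℚ ≤ r + ε → 0ℚ ≤ c + ε → r * c < G + ε + ε →
      ((r + ε) * (r + ε) + 2ℚ * ε) * ((c + ε) * (c + ε) + 2ℚ * ε) ≤ [G+2]²+2 G
    product-bound B G ε r c 0≤B 0<ε scale r≤B c≤B 0≤r′ 0≤c′ rc< = begin
      (r′ * r′ + 2ℚ * ε) * (c′ * c′ + 2ℚ * ε)
        ≡⟨ solve 3 (λ r c e → (r :* r :+ con 2ℚ :* e) :* (c :* c :+ con 2ℚ :* e) :=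
             r :* c :* (r :* c) :+ (con 2ℚ :* e :* (r :* r :+ c :* c) :+ con 4ℚ :* e :* e)) refl r′ c′ ε ⟩
      r′ * c′ * (r′ * c′) + (2ℚ * ε * (r′ * r′ + c′ * c′) + 4ℚ * ε * ε)
        ≤⟨ +-mono-≤ (*-mono-≤ 0≤r′c′ (≤-trans 0≤r′c′ r′c′≤) r′c′≤ r′c′≤)
             (+-mono-≤ (*-monoˡ-≤ (0≤* (nonNegative⁻¹ 2ℚ) 0≤ε)
                 (+-mono-≤ (*-mono-≤ 0≤r′ 0≤B+1 r′≤ r′≤) (*-mono-≤ 0≤c′ 0≤B+1 c′≤ c′≤)))
               (*-mono-≤ (0≤* (nonNegative⁻¹ 4ℚ) 0≤ε) (nonNegative⁻¹ 1ℚ) 4ε≤1 ε≤1)) ⟩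
      (G + 2ℚ) * (G + 2ℚ) + (2ℚ * ε * ((B + 1ℚ) * (B + 1ℚ) + (B + 1ℚ) * (B + 1ℚ)) + 1ℚ * 1ℚ)
        ≡⟨ cong (λ s → (G + 2ℚ) * (G + 2ℚ) + (s + 1ℚ * 1ℚ)) (trans
             (solve 2 (λ e b → con 2ℚ :* e :* (b :+ b) := con 4ℚ :* b :* e) refl ε ((B + 1ℚ) * (B + 1ℚ)))
             scale) ⟩
      [G+2]²+2 G ∎
      where
      open ≤-Reasoning
      r′ c′ : ℚ
      r′ = r + ε
      c′ = c + ε
      0≤ε : 0ℚ ≤ ε
      0≤ε = <⇒≤ 0<ε
      0≤B+1 : 0ℚ ≤ B + 1ℚ
      0≤B+1 = 0≤+ 0≤B (nonNegative⁻¹ 1ℚ)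
      4[B+1]ε≤1 : 4ℚ * (B + 1ℚ) * ε ≤ 1ℚ
      4[B+1]ε≤1 = subst (4ℚ * (B + 1ℚ) * ε ≤_) scale
        (≤-by (0≤* (0≤* (nonNegative⁻¹ 4ℚ) (0≤* 0≤B 0≤B+1)) 0≤ε)
          (solve 2 (λ B e → con 4ℚ :* (B :* (B :+ con 1ℚ)) :* e :=
            con 4ℚ :* ((B :+ con 1ℚ) :* (B :+ con 1ℚ)) :* e :- con 4ℚ :* (B :+ con 1ℚ) :* e) refl B ε))
      4ε≤1 : 4ℚ * ε ≤ 1ℚ
      4ε≤1 = ≤-trans (≤-by (0≤* (0≤* (nonNegative⁻¹ 4ℚ) 0≤B) 0≤ε)
        (solve 2 (λ B e → con 4ℚ :* B :* e := con 4ℚ :* (B :+ con 1ℚ) :* e :- con 4ℚ :* e) refl B ε))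
        4[B+1]ε≤1
      ε≤1 : ε ≤ 1ℚ
      ε≤1 = ≤-trans (≤-by (0≤+ (0≤* (nonNegative⁻¹ 2ℚ) 0≤ε) 0≤ε)
        (solve 1 (λ e → con 2ℚ :* e :+ e := con 4ℚ :* e :- e) refl ε)) 4ε≤1
      r′≤ : r′ ≤ B + 1ℚ
      r′≤ = +-mono-≤ r≤B ε≤1
      c′≤ : c′ ≤ B + 1ℚ
      c′≤ = +-mono-≤ c≤B ε≤1
      0≤r′c′ : 0ℚ ≤ r′ * c′
      0≤r′c′ = 0≤* 0≤r′ 0≤c′
      r′c′≤ : r′ * c′ ≤ G + 2ℚ
      r′c′≤ = ≤-by
        (0≤+ (0≤+ (0≤diff (<⇒≤ rc<)) (0≤* 0≤ε (0≤+ (0≤diff r′≤) (0≤diff c′≤))))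
          (0≤+ (0≤+ (0≤* (nonNegative⁻¹ ½) (0≤diff 4[B+1]ε≤1)) (0≤* (nonNegative⁻¹ ½) (0≤diff 4ε≤1)))
            (0≤+ (nonNegative⁻¹ 1ℚ) (0≤² ε))))
        (solve 5 (λ B G e r c →
          (G :+ e :+ e :- r :* c) :+ e :* ((B :+ con 1ℚ :- (r :+ e)) :+ (B :+ con 1ℚ :- (c :+ e))) :+
            (con ½ :* (con 1ℚ :- con 4ℚ :* (B :+ con 1ℚ) :* e) :+ con ½ :* (con 1ℚ :- con 4ℚ :* e) :+
              (con 1ℚ :+ e :* e)) :=
          G :+ con 2ℚ :- (r :+ e) :* (c :+ e)) refl B G ε r c)

    square≤ : ∀ {p e} → 0ℚ ≤ e → e ≤ 1ℚ → p < e → - p < e → p * p ≤ e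
    square≤ {p} {e} 0≤e e≤1 p<e -p<e =
      ≤-by (0≤+ (0≤* (0≤diff (<⇒≤ p<e)) (0≤diff (<⇒≤ -p<e))) (0≤* 0≤e (0≤diff e≤1)))
        (solve 2 (λ p e → (e :- p) :* (e :- (:- p)) :+ e :* (con 1ℚ :- e) := e :- p :* p) refl p e)

  -- The error E = M − UV is absorbed by the extra coordinates of [ U | s E ] and [ V ; ε I ],
  -- where s ε = 1.
  exact-factorization : ∀ {m n k} (M : BoolMatrix m (suc n))
    (U : Fin m → Fin k → ℚ) (V : Fin (suc n) → Fin k → ℚ) {R C ε s Γ : ℚ} →
    0ℚ < R → 0ℚ < C → 0ℚ ≤ ε → ε ≤ 1ℚ → s * ε ≡ 1ℚ →
    (∀ i j → ∣ dot (allFin k) (U i) (V j) - ind (M i j) ∣ < ε * ε * ε * ν n) →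
    (∀ i → dot (allFin k) (U i) (U i) + ε ≤ R) → (∀ j → dot (allFin k) (V j) (V j) + ε ≤ C) →
    R * C ≤ Γ → BoundedFactorization M Γ
  exact-factorization {m} {n} {k} M U V {R} {C} {ε} {s} 0<R 0<C 0≤ε ε≤1 sε≡1 E< U≤ V≤ RC≤Γ = record
    { coordinates = coordinates
    ; u = u ; v = v ; uv≡M = uv≡M
    ; R = R ; C = C ; 0<R = 0<R ; 0<C = 0<C ; ∣u∣²≤R = ∣u∣²≤R ; ∣v∣²≤C = ∣v∣²≤C ; RC≤Γ = RC≤Γ }
    where
    coordinates : List (Fin k ⊎ Fin (suc n))
    coordinates = map inj₁ (allFin k) ++ map inj₂ (allFin (suc n))
    UV E : Fin m → Fin (suc n) → ℚ
    UV i j = dot (allFin k) (U i) (V j)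
    E i j = ind (M i j) - UV i j
    u : Fin m → Fin k ⊎ Fin (suc n) → ℚ
    u i (inj₁ l) = U i l
    u i (inj₂ j) = s * E i j
    v : Fin (suc n) → Fin k ⊎ Fin (suc n) → ℚ
    v j (inj₁ l)  = V j l
    v j (inj₂ j′) = ε * δ j j′
    dot-split : ∀ f g → dot coordinates f g ≡
      dot (allFin k) (λ l → f (inj₁ l)) (λ l → g (inj₁ l)) +
      dot (allFin (suc n)) (λ j → f (inj₂ j)) (λ j → g (inj₂ j))
    dot-split f g = trans (∑-++ (map inj₁ (allFin k)) (map inj₂ (allFin (suc n))) (λ l → f l * g l))
      (cong₂ _+_ (∑-map inj₁ (allFin k) (λ l → f l * g l)) (∑-map inj₂ (allFin (suc n)) (λ l → f l * g l)))
    uv≡M : ∀ i j → dot coordinates (u i) (v j) ≡ ind (M i j)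
    uv≡M i j = begin
      dot coordinates (u i) (v j)
        ≡⟨ dot-split (u i) (v j) ⟩
      UV i j + ∑ (allFin (suc n)) (λ j′ → s * E i j′ * (ε * δ j j′))
        ≡⟨ cong (UV i j +_) (trans (∑-cong (allFin (suc n)) (λ j′ →
             solve 4 (λ s E e d → s :* E :* (e :* d) := s :* e :* (E :* d)) refl s (E i j′) ε (δ j j′)))
             (trans (∑-*ˡ (allFin (suc n)) (s * ε) (λ j′ → E i j′ * δ j j′))
               (cong₂ _*_ sε≡1 (∑-δ (E i) j)))) ⟩
      UV i j + 1ℚ * E i j
        ≡⟨ solve 2 (λ a b → a :+ con 1ℚ :* (b :- a) := b) refl (UV i j) (ind (M i j)) ⟩
      ind (M i j) ∎
      where open ≡-Reasoning
    -- There are n + 1 columns; squared errors of at most ε³/(n + 1) each, scaled by s² = 1/ε², add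
    -- up to ε.
    tolerance : ℚ
    tolerance = ε * ε * ε * ν n
    0≤tolerance : 0ℚ ≤ tolerance
    0≤tolerance = 0≤* (0≤* (0≤* 0≤ε 0≤ε) 0≤ε) (<⇒≤ (0<ν n))
    tolerance≤1 : tolerance ≤ 1ℚ
    tolerance≤1 = *-mono-≤ (0≤* (0≤* 0≤ε 0≤ε) 0≤ε) (nonNegative⁻¹ 1ℚ)
      (*-mono-≤ (0≤* 0≤ε 0≤ε) (nonNegative⁻¹ 1ℚ) (*-mono-≤ 0≤ε (nonNegative⁻¹ 1ℚ) ε≤1 ε≤1) ε≤1) (ν≤1 n)
    E²≤ : ∀ i j → E i j * E i j ≤ tolerance
    E²≤ i j = square≤ 0≤tolerance tolerance≤1
      (subst (_< tolerance) (solve 2 (λ a b → :- (a :- b) := b :- a) refl (UV i j) (ind (M i j)))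
        (∣p∣<⇒-p< (E< i j)))
      (subst (_< tolerance) (solve 2 (λ a b → a :- b := :- (b :- a)) refl (UV i j) (ind (M i j)))
        (∣p∣<⇒p< (E< i j)))
    ∣u∣²≤R : ∀ i → dot coordinates (u i) (u i) ≤ R
    ∣u∣²≤R i = begin
      dot coordinates (u i) (u i)
        ≡⟨ dot-split (u i) (u i) ⟩
      dot (allFin k) (U i) (U i) + ∑ (allFin (suc n)) (λ j → s * E i j * (s * E i j))
        ≡⟨ cong (dot (allFin k) (U i) (U i) +_) (trans (∑-cong (allFin (suc n)) (λ j →
             solve 2 (λ s E → s :* E :* (s :* E) := s :* s :* (E :* E)) refl s (E i j)))
             (∑-*ˡ (allFin (suc n)) (s * s) (λ j → E i j * E i j))) ⟩
      dot (allFin k) (U i) (U i) + s * s * ∑ (allFin (suc n)) (λ j → E i j * E i j)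
        ≤⟨ +-monoʳ-≤ (dot (allFin k) (U i) (U i)) (*-monoˡ-≤ (0≤² s)
             (∑-mono (allFin (suc n)) (λ {j} _ → E²≤ i j))) ⟩
      dot (allFin k) (U i) (U i) + s * s * ∑ (allFin (suc n)) (λ _ → tolerance)
        ≡⟨ cong (λ t → dot (allFin k) (U i) (U i) + s * s * t)
             (trans (∑-const (allFin (suc n)) tolerance) (cong (_* tolerance) (size-allFin (suc n)))) ⟩
      dot (allFin k) (U i) (U i) + s * s * (ι (suc n) * tolerance)
        ≡⟨ cong (dot (allFin k) (U i) (U i) +_) (trans
             (solve 4 (λ s e N v → s :* s :* (N :* (e :* e :* e :* v)) :=
               s :* e :* (s :* e) :* (N :* v) :* e) refl s ε (ι (suc n)) (ν n))
             (trans (cong₂ (λ a b → a * a * b * ε) sε≡1 (ι*ν≡1 n)) (*-identityˡ ε))) ⟩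
      dot (allFin k) (U i) (U i) + ε
        ≤⟨ U≤ i ⟩
      R ∎
      where open ≤-Reasoning
    ∣v∣²≤C : ∀ j → dot coordinates (v j) (v j) ≤ C
    ∣v∣²≤C j = begin
      dot coordinates (v j) (v j)
        ≡⟨ dot-split (v j) (v j) ⟩
      dot (allFin k) (V j) (V j) + ∑ (allFin (suc n)) (λ j′ → ε * δ j j′ * (ε * δ j j′))
        ≡⟨ cong (dot (allFin k) (V j) (V j) +_) (trans (∑-cong (allFin (suc n)) (λ j′ →
             trans (solve 2 (λ e d → e :* d :* (e :* d) := e :* e :* (d :* d)) refl ε (δ j j′))
               (cong (ε * ε *_) (ind-idem (does (j Finₚ.≟ j′))))))
             (∑-δ (λ _ → ε * ε) j)) ⟩
      dot (allFin k) (V j) (V j) + ε * ε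
        ≤⟨ +-monoʳ-≤ (dot (allFin k) (V j) (V j)) (subst (ε * ε ≤_) (*-identityʳ ε) (*-monoˡ-≤ 0≤ε ε≤1)) ⟩
      dot (allFin k) (V j) (V j) + ε
        ≤⟨ V≤ j ⟩
      C ∎
      where open ≤-Reasoning

  seq-toReal : ∀ {m n} (M : BoolMatrix m n) i j N → seq (toReal M i j) N ≡ ind (M i j)
  seq-toReal M i j N with M i j
  ... | true  = refl
  ... | false = refl

  -- The factorization attaining g is evaluated at one index where finitely many eventual conditions
  -- hold together: entries close to M, norms below r and c up to ε, and rc ≈ g ≤ γ ≤ G.
  γ₂-factorization : ∀ {m n} (M : BoolMatrix (suc m) (suc n)) g → Isγ₂ (toReal M) g →
    ∀ γ → g Defs.≤ γ → ∀ G → Eventually (λ N → seq γ N ≤ G) →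
    BoundedFactorization M ([G+2]²+2 G)
  γ₂-factorization {m} {n} M g ((k , U , V , UV≃M , r , c , r-norm , c-norm , g≃rc) , _) γ g≤γ G γ≤G =
    from-index (proj₁ all-close) (proj₂ all-close (proj₁ all-close) ℕₚ.≤-refl)
    where
    kr = bounded-above {seq r} (cauchy r)
    kc = bounded-above {seq c} (cauchy c)
    β : ℚ
    β = ι (proj₁ kr) + ι (proj₁ kc)
    0≤β : 0ℚ ≤ β
    0≤β = 0≤+ (ι-nonneg (proj₁ kr)) (ι-nonneg (proj₁ kc))
    -- s serves twice: as 1/ε it scales the error block, and sε = 1 is the smallness of ε that
    -- `product-bound` requires.
    s : ℚ
    s = 4ℚ * ((β + 1ℚ) * (β + 1ℚ))
    0<β+1 : 0ℚ < β + 1ℚ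
    0<β+1 = <-≤-trans (positive⁻¹ 1ℚ) (p≤q+p 1ℚ 0≤β)
    1/s = reciprocal {s} (0<* (positive⁻¹ 4ℚ) (0<* 0<β+1 0<β+1))
    ε : ℚ
    ε = proj₁ 1/s
    0<ε : 0ℚ < ε
    0<ε = proj₁ (proj₂ 1/s)
    sε≡1 : s * ε ≡ 1ℚ
    sε≡1 = proj₂ (proj₂ 1/s)
    ε≤1 : ε ≤ 1ℚ
    ε≤1 = subst (ε ≤_) sε≡1 (≤-by
      (0≤* (0≤+ (0≤+ (0≤* (nonNegative⁻¹ 4ℚ) (0≤* 0≤β 0≤β)) (0≤* (nonNegative⁻¹ 8ℚ) 0≤β))
        (nonNegative⁻¹ (2ℚ + 1ℚ))) (<⇒≤ 0<ε))
      (solve 2 (λ B e → (con 4ℚ :* (B :* B) :+ con 8ℚ :* B :+ con (2ℚ + 1ℚ)) :* e :=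
        con 4ℚ :* ((B :+ con 1ℚ) :* (B :+ con 1ℚ)) :* e :- e) refl β ε))
    tolerance : ℚ
    tolerance = ε * ε * ε * ν n

    Entries Rows Columns : ℕ → Set
    Entries N = ∀ i j → ∣ dot (allFin k) (λ l → seq (U i l) N) (λ l → seq (V l j) N) - ind (M i j) ∣ < tolerance
    Rows N = ∀ i → 0ℚ ≤ seq r N + ε ×
      dot (allFin k) (λ l → seq (U i l) N) (λ l → seq (U i l) N) ≤ (seq r N + ε) * (seq r N + ε) + ε
    Columns N = ∀ j → 0ℚ ≤ seq c N + ε ×
      dot (allFin k) (λ l → seq (V l j) N) (λ l → seq (V l j) N) ≤ (seq c N + ε) * (seq c N + ε) + ε

    entries-close : Eventually Entries
    entries-close = eventually-∀ λ i → eventually-∀ λ j → eventually-map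
      (λ N → subst₂ (λ a b → ∣ a - b ∣ < tolerance) (seq-∑ (λ l → U i l Defs.* V l j) N) (seq-toReal M i j N))
      (UV≃M i j tolerance (0<* (0<* (0<* 0<ε 0<ε) 0<ε) (0<ν n)))

    AllClose : ℕ → Set
    AllClose N = Entries N × Rows N × Columns N × seq r N ≤ ι (proj₁ kr) × seq c N ≤ ι (proj₁ kc) ×
      seq γ N ≤ G × seq g N < seq γ N + ε × ∣ seq g N - seq r N * seq c N ∣ < ε

    all-close : Eventually AllClose
    all-close = eventually-× entries-close (eventually-× (norms-eventually-bounded U r r-norm 0<ε)
      (eventually-× (norms-eventually-bounded (λ j l → V l j) c c-norm 0<ε)
      (eventually-× (proj₂ kr) (eventually-× (proj₂ kc) (eventually-× γ≤G
      (eventually-× (g≤γ ε 0<ε) (g≃rc ε 0<ε)))))))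

    from-index : ∀ N → AllClose N → BoundedFactorization M ([G+2]²+2 G)
    from-index N (entries , rows , columns , r≤ , c≤ , γ≤ , g<γ+ε , g~rc) =
      exact-factorization M (λ i l → seq (U i l) N) (λ j l → seq (V l j) N)
        {(seq r N + ε) * (seq r N + ε) + 2ℚ * ε} {(seq c N + ε) * (seq c N + ε) + 2ℚ * ε} {ε} {s}
        (positive-bound (seq r N + ε)) (positive-bound (seq c N + ε)) (<⇒≤ 0<ε) ε≤1 sε≡1 entries
        (λ i → widen (seq r N + ε) (proj₂ (rows i))) (λ j → widen (seq c N + ε) (proj₂ (columns j)))
        (product-bound β G ε (seq r N) (seq c N) 0≤β 0<ε sε≡1
          (≤-trans r≤ (p≤p+q (ι (proj₁ kr)) (ι-nonneg (proj₁ kc))))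
          (≤-trans c≤ (p≤q+p (ι (proj₁ kc)) (ι-nonneg (proj₁ kr))))
          -- The signs of r + ε and c + ε are read off at the first row and the first column, which
          -- exist because both dimensions are successors.
          (proj₁ (rows Fin.zero)) (proj₁ (columns Fin.zero))
          (<-≤-trans (-<⇒< {seq r N * seq c N} {seq g N} (subst (_< ε)
              (solve 2 (λ g p → :- (g :- p) := p :- g) refl (seq g N) (seq r N * seq c N)) (∣p∣<⇒-p< g~rc)))
            (+-monoˡ-≤ ε (≤-trans (<⇒≤ g<γ+ε) (+-monoˡ-≤ ε γ≤)))))
      where
      positive-bound : ∀ a → 0ℚ < a * a + 2ℚ * ε
      positive-bound a = <-≤-trans (0<* (positive⁻¹ 2ℚ) 0<ε) (p≤q+p (2ℚ * ε) (0≤² a))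
      widen : ∀ {a} b → a ≤ b * b + ε → a + ε ≤ b * b + 2ℚ * ε
      widen b a≤b²+ε = ≤-trans (+-monoˡ-≤ ε a≤b²+ε)
        (≤-reflexive (solve 2 (λ b e → b :* b :+ e :+ e := b :* b :+ con 2ℚ :* e) refl b ε))

  -- The constant d and the count of ones

  linearConstant : ℕ → ℚ → ℕ
  linearConstant t Γ = proj₁ (archimedean (sparsity Γ (ι t) i i))
    where
    i : ℕ
    i = proj₁ (archimedean (4ℚ * Γ + 1ℚ))

  numOnes-bound : ∀ {m n t Γ} (M : BoolMatrix m n) → NoBiclique t M → BoundedFactorization M Γ →
    numOnes M ℕ.≤ linearConstant t Γ ℕ.* (m ℕ.+ n)
  numOnes-bound {m} {n} {t} {Γ} M free φ = ι-cancel-≤ (begin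
    ι (numOnes M)
      ≡⟨ numOnes≡edges M ⟩
    edges M (allFin m) (allFin n)
      ≤⟨ Descent.edges-in-balls φ {t} free i i {ζ = λ _ → 0ℚ} {η = λ _ → 0ℚ}
           (Uniqueₚ.allFin⁺ m) (Uniqueₚ.allFin⁺ n)
           (All.tabulate (λ {x} _ → Balls.inBall-initial φ {i} 4Γ+1≤i x))
           (All.tabulate (λ {y} _ → Balls.inBall-initial (transpose φ) {i} 4Γ+1≤i y)) ⟩
    sparsity Γ (ι t) i i * (size (allFin m) + size (allFin n))
      ≡⟨ cong (sparsity Γ (ι t) i i *_)
           (trans (cong₂ _+_ (size-allFin m) (size-allFin n)) (sym (ι-+ m n))) ⟩
    sparsity Γ (ι t) i i * ι (m ℕ.+ n)
      ≤⟨ *-monoʳ-≤ (ι-nonneg (m ℕ.+ n)) (proj₂ (archimedean (sparsity Γ (ι t) i i))) ⟩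
    ι (linearConstant t Γ) * ι (m ℕ.+ n)
      ≡⟨ ι-* (linearConstant t Γ) (m ℕ.+ n) ⟨
    ι (linearConstant t Γ ℕ.* (m ℕ.+ n)) ∎)
    where
    open ≤-Reasoning
    i : ℕ
    i = proj₁ (archimedean (4ℚ * Γ + 1ℚ))
    4Γ+1≤i : 4ℚ * Γ + 1ℚ ≤ ι i
    4Γ+1≤i = proj₂ (archimedean (4ℚ * Γ + 1ℚ))

open import Data.Product.Base using (_,_)
open import Defs
open RationalFactorizations

theorem1p2 : (t : ℕ) → 2 ℕ.≤ t → (γ : ℝ) → 0ℝ < γ →
    ∃[ d ] ((m n : ℕ) → 1 ℕ.≤ m → 1 ℕ.≤ n → (M : BoolMatrix m n) →
    ¬ HasAllOnesSubmatrix t M →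
    (g : ℝ) → Isγ₂ (toReal M) g → g ≤ γ →
    numOnes M ℕ.≤ d ℕ.* (m ℕ.+ n))
theorem1p2 t _ γ _ =
  -- The bound k is taken from γ rather than from g, so that the constant is fixed before m, n and M
  -- are given.
  let k , γ≤k = bounded-above {seq γ} (cauchy γ) in
  linearConstant t ([G+2]²+2 (ι k)) ,
  λ { (ℕ.suc m) (ℕ.suc n) _ _ M no-ones g isγ₂ g≤γ →
    numOnes-bound M (noBiclique {M = M} no-ones) (γ₂-factorization M g isγ₂ γ g≤γ (ι k) γ≤k) }
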